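{- Let $0<q<1$, let $n,i$ be integers with $1\le i\le n$, and let $x\in[0,1]$. Then $$\frac{1}{([1-x]_q+[x]_q)^{n-i}}\sum_{k=i-1}^n\frac{\binom{k}{i}}{\binom{n}{i}}B_{k,n}(x,q)=\sum_{k=0}^i q^{\binom{k}{2}}\binom{x}{k}_q[k]_q!\,S(i,k:q).$$
   Context: Let $q$ be a real number with $0<q<1$. For real $x$, the $q$-number is $[x]_q=\frac{1-q^x}{1-q}$. For a nonnegative integer $k$ and $x\in[0,1]$, the modified $q$-Bernstein polynomials $B_{k,n}(x,q)$, $n=0,1,2,\dots$, are defined by the generating function $$\frac{t^k e^{[1-x]_q t}[x]_q^k}{k!}=\sum_{n=0}^\infty B_{k,n}(x,q)\frac{t^n}{n!}.$$ Here $\binom{k}{i}=0$ when $k<i$. Let $[0]_q!=1$ and $[k]_q!=[k]_q[k-1]_q\cdots[1]_q$. The Gaussian binomial coefficient is $\binom{k}{j}_q=\frac{[k]_q!}{[j]_q![k-j]_q!}$ for $0\le j\le k$. For real $x$, $\binom{x}{k}_q=\frac{[x]_q[x-1]_q\cdots[x-k+1]_q}{[k]_q!}$, with $\binom{x}{0}_q=1$. The $q$-Stirling numbers of the second kind are $$S(n,k:q)=\frac{q^{ -\binom{k}{2}}}{[k]_q!}\sum_{j=0}^k(-1)^j q^{\binom{j}{2}}\binom{k}{j}_q[k-j]_q^{\,n},$$ with the convention $0^0=1$. -}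

module Defs where

open import Algebra.Bundles using (CommutativeRing; Semiring)
import Algebra.Definitions.RawSemiring as RawSemiringDefs
open import Data.Fin.Base using (toℕ)
open import Data.Integer.Base using (ℤ; +_; -[1+_])
open import Data.Nat.Base as ℕ using (ℕ; zero; suc; _∸_; _!)
open import Data.Nat.Combinatorics using (_C_)
open import Data.Nat.Properties using (_≟_)
open import Data.Product.Base using (_×_; ∃; ∃-syntax)
open import Data.Rational.Unnormalised.Base using (ℚᵘ; ↥_; ↧ₙ_)
open import Level using (0ℓ)
import Relation.Binary.Construct.NonStrictToStrict as NonStrictToStrict
open import Relation.Binary.Core using (Rel)
open import Relation.Binary.Structures using (IsDecTotalOrder)
open import Relation.Nullary.Decidable.Core using (yes; no)
open import Relation.Unary using (Pred)

-- The classical real numbers, given by the axioms of a Dedekind-complete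
-- ordered field, which determine ℝ up to unique isomorphism.  The inverse and
-- the supremum are total operations; their values at 0, and at empty or
-- unbounded sets, are unspecified.
record CompleteOrderedField : Set₁ where
  infix  4 _≤_ _<_
  infix  8 _⁻¹
  infixl 7 _/_

  field
    commutativeRing : CommutativeRing 0ℓ 0ℓ

  open CommutativeRing commutativeRing public

  field
    _≤_             : Rel Carrier 0ℓ
    isDecTotalOrder : IsDecTotalOrder _≈_ _≤_
    +-monoˡ-≤       : ∀ z {x y} → x ≤ y → x + z ≤ y + z
    *-nonneg        : ∀ {x y} → 0# ≤ x → 0# ≤ y → 0# ≤ x * y
    1≉0             : 1# ≉ 0#
    _⁻¹             : Carrier → Carrier
    ⁻¹-inverseʳ     : ∀ {x} → x ≉ 0# → x * x ⁻¹ ≈ 1#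

  IsUpperBound : Pred Carrier 0ℓ → Carrier → Set
  IsUpperBound P b = ∀ x → P x → x ≤ b

  IsLeastUpperBound : Pred Carrier 0ℓ → Carrier → Set
  IsLeastUpperBound P s = IsUpperBound P s × (∀ b → IsUpperBound P b → s ≤ b)

  field
    sup       : Pred Carrier 0ℓ → Carrier
    sup-isLub : ∀ P → ∃ P → ∃ (IsUpperBound P) → IsLeastUpperBound P (sup P)

  _<_ : Rel Carrier 0ℓ
  _<_ = NonStrictToStrict._<_ _≈_ _≤_

  _/_ : Carrier → Carrier → Carrier
  x / y = x * y ⁻¹

  open RawSemiringDefs (Semiring.rawSemiring semiring) public using (_^_; sum) renaming (_×_ to _·_)

  fromℕ : ℕ → Carrier
  fromℕ n = n · 1#

  fromℤ : ℤ → Carrier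
  fromℤ (+ n)    = fromℕ n
  fromℤ -[1+ n ] = - fromℕ (suc n)

  fromℚ : ℚᵘ → Carrier
  fromℚ r = fromℤ (↥ r) / fromℕ (↧ₙ r)

  infixr 8 _^ℤ_
  _^ℤ_ : Carrier → ℤ → Carrier
  x ^ℤ (+ n)    = x ^ n
  x ^ℤ -[1+ n ] = (x ^ suc n) ⁻¹

  -- y is a ^ r, i.e. the positive d-th root of a ^ m, where r = m / d.
  IsRationalPower : Carrier → ℚᵘ → Carrier → Set
  IsRationalPower a r y = 0# < y × y ^ (↧ₙ r) ≈ a ^ℤ (↥ r)

  -- The real power a ^ x for a base 0 < a ≤ 1 only: since r ↦ a ^ r is then
  -- antitone, a ^ x is the supremum of the a ^ r over the rationals r ≥ x.
  infixr 8 _^ℝ_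
  _^ℝ_ : Carrier → Carrier → Carrier
  a ^ℝ x = sup λ y → ∃[ r ] (x ≤ fromℚ r × IsRationalPower a r y)

  -- ∑[ a ⋯ b ] f = f a + f (a + 1) + ... + f b, empty when b < a.
  ∑[_⋯_] : ℕ → ℕ → (ℕ → Carrier) → Carrier
  ∑[ a ⋯ b ] f = sum {suc b ∸ a} λ j → f (a ℕ.+ toℕ j)

-- Formal power series in one variable t, as sequences of coefficients.
module PowerSeries (R : CompleteOrderedField) where
  open CompleteOrderedField R

  Series : Set
  Series = ℕ → Carrier

  infix 4 _≋_
  _≋_ : Series → Series → Set
  f ≋ g = ∀ n → f n ≈ g n

  infixl 7 _⊛_
  _⊛_ : Series → Series → Series
  (f ⊛ g) n = ∑[ 0 ⋯ n ] λ j → f j * g (n ∸ j)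

  infixr 8 t^_
  t^_ : ℕ → Series
  (t^ k) n with k ≟ n
  ... | yes _ = 1#
  ... | no  _ = 0#

  const : Carrier → Series
  const c zero    = c
  const c (suc _) = 0#

  -- ∑ₙ bₙ tⁿ / n!
  egf : (ℕ → Carrier) → Series
  egf b n = b n / fromℕ (n !)

  -- e^(c t)
  exp[_t] : Carrier → Series
  exp[ c t] = egf (c ^_)

module QBernstein (R : CompleteOrderedField) (q : CompleteOrderedField.Carrier R) where
  open CompleteOrderedField R
  open PowerSeries R

  [_] : Carrier → Carrier
  [ x ] = (1# - q ^ℝ x) / (1# - q)

  [_]! : ℕ → Carrier
  [ zero  ]! = 1#
  [ suc k ]! = [ fromℕ (suc k) ] * [ k ]!

  -- Meaningful for j ≤ k.
  gaussBinomial : ℕ → ℕ → Carrier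
  gaussBinomial k j = [ k ]! / ([ j ]! * [ k ∸ j ]!)

  -- [x] [x-1] ⋯ [x-k+1]
  qFalling : Carrier → ℕ → Carrier
  qFalling x zero    = 1#
  qFalling x (suc k) = qFalling x k * [ x - fromℕ k ]

  qBinomial : Carrier → ℕ → Carrier
  qBinomial x k = qFalling x k / [ k ]!

  -- The q-Stirling numbers of the second kind, S(n, k : q).
  S : ℕ → ℕ → Carrier
  S n k = ((q ^ (k C 2)) ⁻¹ / [ k ]!) *
    ∑[ 0 ⋯ k ] λ j →
      (- 1#) ^ j * q ^ (j C 2) * gaussBinomial k j * [ fromℕ (k ∸ j) ] ^ n

  bernsteinSeries : ℕ → Carrier → Series
  bernsteinSeries k x =
    t^ k ⊛ exp[ [ 1# - x ] t] ⊛ const ([ x ] ^ k / fromℕ (k !))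

  -- B k n x is B_{k,n}(x, q).
  IsModifiedBernstein : (ℕ → ℕ → Carrier → Carrier) → Set
  IsModifiedBernstein B = ∀ k x → 0# ≤ x → x ≤ 1# →
    bernsteinSeries k x ≋ egf (λ n → B k n x)

{-# OPTIONS --safe #-}
module Submission where

-- Put a = [x] and b = [1 - x].  Reading off coefficients of the generating function gives
-- B_{k,n} = C(n,k) a^k b^(n-k), and C(k,i) C(n,k) = C(n,i) C(n-i,k-i) turns the left-hand side into
-- a^i (a + b)^(n-i) / (a + b)^(n-i) = a^i.
-- The right-hand side is the q-Newton expansion of a^i.  It follows by induction on i from
-- [x] = [k] + q^k [x-k] and the recurrence S(i+1,k) = S(i,k-1) + [k] S(i,k), together with
-- S(0,k) = 0 for k > 0, where the alternating sum of Gaussian binomials telescopes by q-Pascal.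
-- About real powers only three facts are needed: q^(x+1) = q q^x, q^0 = 1, and q^x < 1 for x ≥ 1/2,
-- the last one because a + b could only vanish if q^x = q^(1-x) = 1.

open import Data.Empty using (⊥)
open import Data.Fin.Base using (toℕ)
open import Data.Integer.Base as ℤ using (+_; -[1+_])
import Data.Integer.Properties as ℤ
open import Data.Nat.Base as ℕ using (ℕ; zero; suc; _∸_; _!; z≤n; s≤s)
open import Data.Nat.Combinatorics using (_C_; nC1≡n; nCk+nC[k+1]≡[n+1]C[k+1]; nCk≡n!/k![n-k]!; k![n∸k]!∣n!; k>n⇒nCk≡0)
open import Data.Nat.DivMod using (m/n*n≡m)
import Data.Nat.Properties as ℕ
open import Data.Nat.Solver using (module +-*-Solver)
open import Data.Product.Base using (_×_; _,_; proj₁; proj₂; ∃; ∃-syntax)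
open import Data.Rational.Unnormalised.Base using (mkℚᵘ)
open import Data.Sum.Base using (_⊎_; inj₁; inj₂)
open import Function.Base using (_∘_)
open import Level using (0ℓ)
open import Relation.Binary.Bundles using (Poset)
open import Relation.Binary.PropositionalEquality.Core as ≡ using (_≡_; _≢_)
import Relation.Binary.PropositionalEquality.Properties as ≡
import Relation.Binary.Reasoning.PartialOrder as PartialOrderReasoning
import Relation.Binary.Reasoning.Setoid as SetoidReasoning
open import Relation.Binary.Structures using (IsDecTotalOrder)
open import Relation.Nullary.Decidable.Core using (yes; no)
open import Relation.Nullary.Negation.Core using (contradiction)
open import Relation.Unary using (Pred)
open import Defs

-- Ordered field arithmetic

-- The real power is the main obstacle. `sup` is unspecified on empty or unbounded sets, so a value
-- of `q ^ℝ x` means something only once the rational powers are known to be inhabited and bounded.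
-- For x in [0,1] this is direct, but `qFalling` contains [x-k] with x - k possibly negative; there
-- existence is transported by unit shifts, since r ↦ r + 1 multiplies the whole set of rational
-- powers by q. Division by a power of a + b is meaningful only if a + b is nonzero. That q^r < 1
-- for each rational r > 0 does not survive the passage to a supremum, so a bound uniform in r is
-- required. (1+q)/2 is one for all r ≥ 1/2, and one of x and 1 - x is always at least 1/2. The
-- Stirling numbers are treated without their normalising factor, which keeps inverses out of the
-- recurrence.

module FieldProperties (R : CompleteOrderedField) where
  open CompleteOrderedField R
  open IsDecTotalOrder isDecTotalOrder public
    using (antisym; total)
    renaming (refl to ≤-refl; reflexive to ≤-reflexive; trans to ≤-trans)
  open import Algebra.Properties.Ring ring public using (-1*x≈-x; x[y-z]≈xy-xz)
  open import Algebra.Properties.Group +-group public using (//-rightDividesˡ; //-rightDividesʳ)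
    renaming (⁻¹-involutive to -‿involutive; x∙y⁻¹≈ε⇒x≈y to x-y≈0⇒x≈y)
  open import Algebra.Properties.Semiring.Exp semiring public using (^-congˡ; ^-homo-*; ^-assocʳ)
  open import Algebra.Properties.CommutativeSemiring.Exp commutativeSemiring public using (^-distrib-*)
  open import Algebra.Properties.Semiring.Mult semiring public using (×1-homo-*)
  module ≈-Reasoning = SetoidReasoning setoid

  poset : Poset 0ℓ 0ℓ 0ℓ
  poset = record { isPartialOrder = IsDecTotalOrder.isPartialOrder isDecTotalOrder }

  module ≤-Reasoning = PartialOrderReasoning poset

  private
    variable
      x y z : Carrier

  ⁻¹-inverseˡ : x ≉ 0# → x ⁻¹ * x ≈ 1#
  ⁻¹-inverseˡ x≉0 = trans (*-comm _ _) (⁻¹-inverseʳ x≉0)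

  *-cancelʳ-≉0 : z ≉ 0# → x * z ≈ y * z → x ≈ y
  *-cancelʳ-≉0 {z} {x} {y} z≉0 eq = begin
    x               ≈⟨ *-identityʳ x ⟨
    x * 1#          ≈⟨ *-congˡ (⁻¹-inverseʳ z≉0) ⟨
    x * (z * z ⁻¹)  ≈⟨ *-assoc x z _ ⟨
    x * z * z ⁻¹    ≈⟨ *-congʳ eq ⟩
    y * z * z ⁻¹    ≈⟨ *-assoc y z _ ⟩
    y * (z * z ⁻¹)  ≈⟨ *-congˡ (⁻¹-inverseʳ z≉0) ⟩
    y * 1#          ≈⟨ *-identityʳ y ⟩
    y               ∎
    where open ≈-Reasoning

  *-≉0 : x ≉ 0# → y ≉ 0# → x * y ≉ 0#
  *-≉0 {x} {y} x≉0 y≉0 xy≈0 = x≉0 (*-cancelʳ-≉0 y≉0 (trans xy≈0 (sym (zeroˡ y))))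

  ^-≉0 : x ≉ 0# → ∀ n → x ^ n ≉ 0#
  ^-≉0 x≉0 zero    = 1≉0
  ^-≉0 x≉0 (suc n) = *-≉0 x≉0 (^-≉0 x≉0 n)

  /-*-cancel : y ≉ 0# → x / y * y ≈ x
  /-*-cancel {y} {x} y≉0 = begin
    x * y ⁻¹ * y    ≈⟨ *-assoc x _ y ⟩
    x * (y ⁻¹ * y)  ≈⟨ *-congˡ (⁻¹-inverseˡ y≉0) ⟩
    x * 1#          ≈⟨ *-identityʳ x ⟩
    x               ∎
    where open ≈-Reasoning

  *-/-cancel : y ≉ 0# → x * y / y ≈ x
  *-/-cancel {y} {x} y≉0 = begin
    x * y * y ⁻¹    ≈⟨ *-assoc x y _ ⟩
    x * (y * y ⁻¹)  ≈⟨ *-congˡ (⁻¹-inverseʳ y≉0) ⟩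
    x * 1#          ≈⟨ *-identityʳ x ⟩
    x               ∎
    where open ≈-Reasoning

  x≤y⇒0≤y-x : x ≤ y → 0# ≤ y - x
  x≤y⇒0≤y-x {x} {y} x≤y = begin
    0#     ≈⟨ -‿inverseʳ x ⟨
    x - x  ≤⟨ +-monoˡ-≤ (- x) x≤y ⟩
    y - x  ∎
    where open ≤-Reasoning

  0≤y-x⇒x≤y : 0# ≤ y - x → x ≤ y
  0≤y-x⇒x≤y {y} {x} 0≤y-x = begin
    x          ≈⟨ +-identityˡ x ⟨
    0# + x     ≤⟨ +-monoˡ-≤ x 0≤y-x ⟩
    y - x + x  ≈⟨ //-rightDividesˡ x y ⟩
    y          ∎
    where open ≤-Reasoning

  +-monoʳ-≤ : ∀ z → x ≤ y → z + x ≤ z + y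
  +-monoʳ-≤ {x} {y} z x≤y = begin
    z + x  ≈⟨ +-comm z x ⟩
    x + z  ≤⟨ +-monoˡ-≤ z x≤y ⟩
    y + z  ≈⟨ +-comm y z ⟩
    z + y  ∎
    where open ≤-Reasoning

  +-cancelʳ-≤ : ∀ z → x + z ≤ y + z → x ≤ y
  +-cancelʳ-≤ {x} {y} z le = begin
    x          ≈⟨ //-rightDividesʳ z x ⟨
    x + z - z  ≤⟨ +-monoˡ-≤ (- z) le ⟩
    y + z - z  ≈⟨ //-rightDividesʳ z y ⟩
    y          ∎
    where open ≤-Reasoning

  x+y≈0⇒x≈0 : 0# ≤ x → 0# ≤ y → x + y ≈ 0# → x ≈ 0#
  x+y≈0⇒x≈0 {x} {y} 0≤x 0≤y x+y≈0 = antisym (begin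
    x       ≈⟨ +-identityʳ x ⟨
    x + 0#  ≤⟨ +-monoʳ-≤ x 0≤y ⟩
    x + y   ≈⟨ x+y≈0 ⟩
    0#      ∎) 0≤x
    where open ≤-Reasoning

  *-monoʳ-≤ : 0# ≤ z → x ≤ y → z * x ≤ z * y
  *-monoʳ-≤ {z} {x} {y} 0≤z x≤y = 0≤y-x⇒x≤y (begin
    0#             ≤⟨ *-nonneg 0≤z (x≤y⇒0≤y-x x≤y) ⟩
    z * (y - x)    ≈⟨ x[y-z]≈xy-xz z y x ⟩
    z * y - z * x  ∎)
    where open ≤-Reasoning

  *-monoˡ-≤ : 0# ≤ z → x ≤ y → x * z ≤ y * z
  *-monoˡ-≤ {z} {x} {y} 0≤z x≤y = begin
    x * z  ≈⟨ *-comm x z ⟩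
    z * x  ≤⟨ *-monoʳ-≤ 0≤z x≤y ⟩
    z * y  ≈⟨ *-comm z y ⟩
    y * z  ∎
    where open ≤-Reasoning

  0<x⇒x≉0 : 0# < x → x ≉ 0#
  0<x⇒x≉0 (_ , 0≉x) x≈0 = 0≉x (sym x≈0)

  *-cancelʳ-≤ : 0# < z → x * z ≤ y * z → x ≤ y
  *-cancelʳ-≤ {z} {x} {y} 0<z xz≤yz with total x y
  ... | inj₁ x≤y = x≤y
  -- Multiplying back makes the two products equal, so cancellation in the field applies.
  ... | inj₂ y≤x = ≤-reflexive
    (*-cancelʳ-≉0 (0<x⇒x≉0 0<z) (antisym xz≤yz (*-monoˡ-≤ (proj₁ 0<z) y≤x)))

  0≤1 : 0# ≤ 1#
  0≤1 with total 0# 1#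
  ... | inj₁ 0≤1 = 0≤1
  ... | inj₂ 1≤0 = begin
    0#             ≤⟨ *-nonneg 0≤-1 0≤-1 ⟩
    - 1# * - 1#    ≈⟨ -1*x≈-x (- 1#) ⟩
    - (- 1#)       ≈⟨ -‿involutive 1# ⟩
    1#             ∎
    where
    open ≤-Reasoning
    0≤-1 : 0# ≤ - 1#
    0≤-1 = ≤-trans (x≤y⇒0≤y-x 1≤0) (≤-reflexive (+-identityˡ (- 1#)))

  *-pos : 0# < x → 0# < y → 0# < x * y
  *-pos 0<x 0<y = *-nonneg (proj₁ 0<x) (proj₁ 0<y) ,
    λ 0≈xy → *-≉0 (0<x⇒x≉0 0<x) (0<x⇒x≉0 0<y) (sym 0≈xy)

  ^-pos : 0# < x → ∀ n → 0# < x ^ n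
  ^-pos 0<x zero    = 0≤1 , λ 0≈1 → 1≉0 (sym 0≈1)
  ^-pos 0<x (suc n) = *-pos 0<x (^-pos 0<x n)

  ⁻¹-pos : 0# < x → 0# < x ⁻¹
  ⁻¹-pos {x} 0<x = *-cancelʳ-≤ 0<x (begin
      0# * x    ≈⟨ zeroˡ x ⟩
      0#        ≤⟨ 0≤1 ⟩
      1#        ≈⟨ ⁻¹-inverseˡ x≉0 ⟨
      x ⁻¹ * x  ∎)
    , λ 0≈x⁻¹ → 1≉0 (trans (sym (⁻¹-inverseʳ x≉0)) (trans (*-congˡ (sym 0≈x⁻¹)) (zeroʳ x)))
    where
    open ≤-Reasoning
    x≉0 = 0<x⇒x≉0 0<x

  ^-mono-≤ : 0# < x → x ≤ y → ∀ n → x ^ n ≤ y ^ n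
  ^-mono-≤ 0<x x≤y zero    = ≤-refl
  ^-mono-≤ {x} {y} 0<x x≤y (suc n) = begin
    x * x ^ n  ≤⟨ *-monoˡ-≤ (proj₁ (^-pos 0<x n)) x≤y ⟩
    y * x ^ n  ≤⟨ *-monoʳ-≤ (≤-trans (proj₁ 0<x) x≤y) (^-mono-≤ 0<x x≤y n) ⟩
    y * y ^ n  ∎
    where open ≤-Reasoning

  -- Stands in for monotonicity of roots: rational powers are compared after raising them to their
  -- denominators.
  ^-cancel-≤ : 0# < x → 0# < y → ∀ n → x ^ suc n ≤ y ^ suc n → x ≤ y
  ^-cancel-≤ {x} {y} 0<x 0<y n le with total x y
  ... | inj₁ x≤y = x≤y
  ... | inj₂ y≤x = *-cancelʳ-≤ (^-pos 0<x n) (≤-trans le (*-monoʳ-≤ (proj₁ 0<y) (^-mono-≤ 0<y y≤x n)))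

  ^-antitone : 0# < x → x ≤ 1# → ∀ {m n} → m ℕ.≤ n → x ^ n ≤ x ^ m
  ^-antitone {x} 0<x x≤1 {n = n} z≤n = begin
    x ^ n   ≤⟨ ^-mono-≤ 0<x x≤1 n ⟩
    1# ^ n  ≈⟨ 1^n≈1 n ⟩
    1#      ∎
    where
    open ≤-Reasoning
    1^n≈1 : ∀ n → 1# ^ n ≈ 1#
    1^n≈1 zero    = refl
    1^n≈1 (suc n) = trans (*-identityˡ _) (1^n≈1 n)
  ^-antitone 0<x x≤1 (s≤s m≤n) = *-monoʳ-≤ (proj₁ 0<x) (^-antitone 0<x x≤1 m≤n)

  fromℕ-≥0 : ∀ n → 0# ≤ fromℕ n
  fromℕ-≥0 zero    = ≤-refl
  fromℕ-≥0 (suc n) = begin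
    0#            ≤⟨ 0≤1 ⟩
    1#            ≈⟨ +-identityʳ 1# ⟨
    1# + 0#       ≤⟨ +-monoʳ-≤ 1# (fromℕ-≥0 n) ⟩
    1# + fromℕ n  ∎
    where open ≤-Reasoning

  1≤fromℕ : ∀ n → 1# ≤ fromℕ (suc n)
  1≤fromℕ n = ≤-trans (≤-reflexive (sym (+-identityʳ 1#))) (+-monoʳ-≤ 1# (fromℕ-≥0 n))

  fromℕ-pos : ∀ n → 0# < fromℕ (suc n)
  fromℕ-pos n = fromℕ-≥0 (suc n) ,
    λ 0≈1+n → 1≉0 (antisym (≤-trans (1≤fromℕ n) (≤-reflexive (sym 0≈1+n))) 0≤1)

  fromℕ-≉0 : ∀ n → .{{ℕ.NonZero n}} → fromℕ n ≉ 0#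
  fromℕ-≉0 (suc n) = 0<x⇒x≉0 (fromℕ-pos n)

  -- Brings comparisons of fractions made in the field back to natural exponents, where `^-antitone`
  -- applies.
  fromℕ-cancel-≤ : ∀ m n → fromℕ m ≤ fromℕ n → m ℕ.≤ n
  fromℕ-cancel-≤ zero    n       _  = z≤n
  fromℕ-cancel-≤ (suc m) zero    le = contradiction (antisym le (fromℕ-≥0 (suc m))) (fromℕ-≉0 (suc m))
  fromℕ-cancel-≤ (suc m) (suc n) le = s≤s (fromℕ-cancel-≤ m n (+-cancelʳ-≤ 1# (begin
    fromℕ m + 1#  ≈⟨ +-comm _ 1# ⟩
    1# + fromℕ m  ≤⟨ le ⟩
    1# + fromℕ n  ≈⟨ +-comm 1# _ ⟩
    fromℕ n + 1#  ∎)))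
    where open ≤-Reasoning

-- Real powers of a base between 0 and 1

module RealPower (R : CompleteOrderedField) where
  open CompleteOrderedField R
  open FieldProperties R
  open import Algebra.Solver.Ring.NaturalCoefficients.Default commutativeSemiring
  open import Algebra.Properties.AbelianGroup +-abelianGroup using () renaming (⁻¹-∙-comm to -‿+-comm)

  private
    variable
      x y z : Carrier

  y⁻¹≈x[xy]⁻¹ : x ≉ 0# → y ≉ 0# → y ⁻¹ ≈ x * (x * y) ⁻¹
  y⁻¹≈x[xy]⁻¹ {x} {y} x≉0 y≉0 = *-cancelʳ-≉0 y≉0 (begin
    y ⁻¹ * y              ≈⟨ ⁻¹-inverseˡ y≉0 ⟩
    1#                    ≈⟨ ⁻¹-inverseʳ (*-≉0 x≉0 y≉0) ⟨
    x * y * (x * y) ⁻¹    ≈⟨ solve 3 (λ x y i → x :* y :* i := x :* i :* y) refl x y _ ⟩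
    x * (x * y) ⁻¹ * y    ∎)
    where open ≈-Reasoning

  ^ℤ-suc : x ≉ 0# → ∀ m → x ^ℤ (ℤ.suc m) ≈ x * x ^ℤ m
  ^ℤ-suc x≉0 (+ n)        = refl
  -- Here the left side is `1#`, which is first rewritten as `1# ⁻¹` to fit the general step.
  ^ℤ-suc x≉0 -[1+ zero ]  = trans (sym (trans (sym (*-identityˡ _)) (⁻¹-inverseʳ 1≉0))) (y⁻¹≈x[xy]⁻¹ x≉0 1≉0)
  ^ℤ-suc x≉0 -[1+ suc n ] = y⁻¹≈x[xy]⁻¹ x≉0 (^-≉0 x≉0 (suc n))

  ^ℤ-+ : x ≉ 0# → ∀ n m → x ^ℤ (+ n ℤ.+ m) ≈ x ^ n * x ^ℤ m
  ^ℤ-+ {x} x≉0 zero m = begin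
    x ^ℤ (+ 0 ℤ.+ m)  ≡⟨ ≡.cong (x ^ℤ_) (ℤ.+-identityˡ m) ⟩
    x ^ℤ m            ≈⟨ *-identityˡ _ ⟨
    1# * x ^ℤ m       ∎
    where open ≈-Reasoning
  ^ℤ-+ {x} x≉0 (suc n) m = begin
    x ^ℤ (+ suc n ℤ.+ m)      ≡⟨ ≡.cong (x ^ℤ_) (ℤ.suc-+ n m) ⟩
    x ^ℤ ℤ.suc (+ n ℤ.+ m)    ≈⟨ ^ℤ-suc x≉0 (+ n ℤ.+ m) ⟩
    x * x ^ℤ (+ n ℤ.+ m)      ≈⟨ *-congˡ (^ℤ-+ x≉0 n m) ⟩
    x * (x ^ n * x ^ℤ m)      ≈⟨ *-assoc x _ _ ⟨
    x ^ suc n * x ^ℤ m        ∎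
    where open ≈-Reasoning

  x-[x+y]≈-y : ∀ x y → x - (x + y) ≈ - y
  x-[x+y]≈-y x y = begin
    x - (x + y)      ≈⟨ +-congˡ (-‿+-comm x y) ⟨
    x + (- x + - y)  ≈⟨ +-assoc x _ _ ⟨
    x + - x + - y    ≈⟨ +-congʳ (-‿inverseʳ x) ⟩
    0# + - y         ≈⟨ +-identityˡ _ ⟩
    - y              ∎
    where open ≈-Reasoning

  fromℤ-suc : ∀ m → fromℤ (ℤ.suc m) ≈ 1# + fromℤ m
  fromℤ-suc (+ n)        = refl
  fromℤ-suc -[1+ zero ]  = sym (trans (+-congˡ (-‿cong (+-identityʳ 1#))) (-‿inverseʳ 1#))
  fromℤ-suc -[1+ suc n ] = sym (x-[x+y]≈-y 1# (fromℕ (suc n)))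

  fromℤ-+ : ∀ n m → fromℤ (+ n ℤ.+ m) ≈ fromℕ n + fromℤ m
  fromℤ-+ zero m = begin
    fromℤ (+ 0 ℤ.+ m)  ≡⟨ ≡.cong fromℤ (ℤ.+-identityˡ m) ⟩
    fromℤ m            ≈⟨ +-identityˡ _ ⟨
    0# + fromℤ m       ∎
    where open ≈-Reasoning
  fromℤ-+ (suc n) m = begin
    fromℤ (+ suc n ℤ.+ m)       ≡⟨ ≡.cong fromℤ (ℤ.suc-+ n m) ⟩
    fromℤ (ℤ.suc (+ n ℤ.+ m))   ≈⟨ fromℤ-suc (+ n ℤ.+ m) ⟩
    1# + fromℤ (+ n ℤ.+ m)      ≈⟨ +-congˡ (fromℤ-+ n m) ⟩
    1# + (fromℕ n + fromℤ m)    ≈⟨ +-assoc 1# _ _ ⟨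
    fromℕ (suc n) + fromℤ m     ∎
    where open ≈-Reasoning

  -- The fraction stays unreduced, so that r and r + 1 share a denominator and hence the same root
  -- index.
  fromℚ-suc : ∀ m d → fromℚ (mkℚᵘ (+ suc d ℤ.+ m) d) ≈ 1# + fromℚ (mkℚᵘ m d)
  fromℚ-suc m d = begin
    fromℤ (+ suc d ℤ.+ m) / fromℕ (suc d)                        ≈⟨ *-congʳ (fromℤ-+ (suc d) m) ⟩
    (fromℕ (suc d) + fromℤ m) / fromℕ (suc d)                    ≈⟨ distribʳ _ _ _ ⟩
    fromℕ (suc d) / fromℕ (suc d) + fromℤ m / fromℕ (suc d)      ≈⟨ +-congʳ (⁻¹-inverseʳ (fromℕ-≉0 (suc d))) ⟩
    1# + fromℤ m / fromℕ (suc d)                                 ∎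
    where open ≈-Reasoning

  lub-unique : ∀ {P s t} → IsLeastUpperBound P s → IsLeastUpperBound P t → s ≈ t
  lub-unique (ubₛ , leastₛ) (ubₜ , leastₜ) = antisym (leastₛ _ ubₜ) (leastₜ _ ubₛ)

  -- Multiplication by `c` and by its inverse `d` preserves order and carries each set into the
  -- other, so upper bounds transfer both ways.
  lub-scale : ∀ {c d P Q s} → 0# ≤ c → 0# ≤ d → c * d ≈ 1# →
    (∀ y → P y → Q (c * y)) → (∀ y → Q y → P (d * y)) →
    IsLeastUpperBound P s → IsLeastUpperBound Q (c * s)
  lub-scale {c} {d} {P} {Q} {s} 0≤c 0≤d cd≈1 P⇒Q Q⇒P (ub , least) = ub′ , least′
    where
    open ≤-Reasoning
    c[dy]≈y : ∀ y → c * (d * y) ≈ y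
    c[dy]≈y y = trans (sym (*-assoc c d y)) (trans (*-congʳ cd≈1) (*-identityˡ y))
    d[cy]≈y : ∀ y → d * (c * y) ≈ y
    d[cy]≈y y = trans (solve 3 (λ c d y → d :* (c :* y) := c :* (d :* y)) refl c d y) (c[dy]≈y y)
    ub′ : IsUpperBound Q (c * s)
    ub′ y Qy = begin
      y            ≈⟨ c[dy]≈y y ⟨
      c * (d * y)  ≤⟨ *-monoʳ-≤ 0≤c (ub _ (Q⇒P y Qy)) ⟩
      c * s        ∎
    least′ : ∀ b → IsUpperBound Q b → c * s ≤ b
    least′ b b-ub = begin
      c * s        ≤⟨ *-monoʳ-≤ 0≤c (least (d * b) λ y Py → begin
        y            ≈⟨ d[cy]≈y y ⟨
        d * (c * y)  ≤⟨ *-monoʳ-≤ 0≤d (b-ub _ (P⇒Q y Py)) ⟩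
        d * b        ∎) ⟩
      c * (d * b)  ≈⟨ c[dy]≈y b ⟩
      b            ∎

  module _ (q : Carrier) (0<q : 0# < q) (q<1 : q < 1#) where

    q≉0 : q ≉ 0#
    q≉0 = 0<x⇒x≉0 0<q

    -- Repeats the set in the definition of `_^ℝ_`, so that `q ^ℝ x` unfolds to
    -- `sup (RationalPowers x)`.
    RationalPowers : Carrier → Pred Carrier 0ℓ
    RationalPowers x y = ∃[ r ] (x ≤ fromℚ r × IsRationalPower q r y)

    -- IsPower x s asserts that the supremum exists, without which q ^ℝ x is a junk value.
    IsPower : Carrier → Carrier → Set
    IsPower x s = ∃ (RationalPowers x) × IsLeastUpperBound (RationalPowers x) s

    IsPower⇒^ℝ : IsPower x y → q ^ℝ x ≈ y
    IsPower⇒^ℝ {y = y} (inhabited , lub) =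
      lub-unique (sup-isLub _ inhabited (y , proj₁ lub)) lub

    RationalPowers-respˡ : x ≈ z → RationalPowers x y → RationalPowers z y
    RationalPowers-respˡ x≈z (r , x≤r , pow) = r , ≤-trans (≤-reflexive (sym x≈z)) x≤r , pow

    IsPower-respˡ : x ≈ z → IsPower x y → IsPower z y
    IsPower-respˡ x≈z ((y , Py) , ub , least) =
      (y , RationalPowers-respˡ x≈z Py) ,
      (λ w Pw → ub w (RationalPowers-respˡ (sym x≈z) Pw)) ,
      λ b b-ub → least b λ w Pw → b-ub w (RationalPowers-respˡ x≈z Pw)

    RationalPowers-suc : ∀ y → RationalPowers x y → RationalPowers (1# + x) (q * y)
    RationalPowers-suc {x} y (mkℚᵘ m d , x≤r , 0<y , y^d≈q^m) =
      mkℚᵘ (+ suc d ℤ.+ m) d ,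
      ≤-trans (+-monoʳ-≤ 1# x≤r) (≤-reflexive (sym (fromℚ-suc m d))) ,
      *-pos 0<q 0<y ,
      (begin
        (q * y) ^ suc d           ≈⟨ ^-distrib-* q y (suc d) ⟩
        q ^ suc d * y ^ suc d     ≈⟨ *-congˡ y^d≈q^m ⟩
        q ^ suc d * q ^ℤ m        ≈⟨ ^ℤ-+ q≉0 (suc d) m ⟨
        q ^ℤ (+ suc d ℤ.+ m)      ∎)
      where open ≈-Reasoning

    RationalPowers-pred : ∀ y → RationalPowers (1# + x) y → RationalPowers x (q ⁻¹ * y)
    RationalPowers-pred {x} y (mkℚᵘ m d , 1+x≤r , 0<y , y^d≈q^m) =
      mkℚᵘ m′ d ,
      +-cancelʳ-≤ 1# (begin
        x + 1#                           ≈⟨ +-comm x 1# ⟩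
        1# + x                           ≤⟨ 1+x≤r ⟩
        fromℚ (mkℚᵘ m d)                 ≡⟨ ≡.cong (λ i → fromℚ (mkℚᵘ i d)) m≡d+m′ ⟩
        fromℚ (mkℚᵘ (+ suc d ℤ.+ m′) d)  ≈⟨ fromℚ-suc m′ d ⟩
        1# + fromℚ (mkℚᵘ m′ d)           ≈⟨ +-comm 1# _ ⟩
        fromℚ (mkℚᵘ m′ d) + 1#           ∎) ,
      *-pos (⁻¹-pos 0<q) 0<y ,
      -- The numerator of r - 1 may be negative; multiplying by `q ^ suc d` reduces the claim to
      -- `^ℤ-+`, whose first summand is a natural number.
      *-cancelʳ-≉0 (^-≉0 q≉0 (suc d)) (begin-equality
        (q ⁻¹ * y) ^ suc d * q ^ suc d   ≈⟨ ^-distrib-* (q ⁻¹ * y) q (suc d) ⟨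
        (q ⁻¹ * y * q) ^ suc d           ≈⟨ ^-congˡ (suc d) (solve 3 (λ i y q → i :* y :* q := y :* i :* q) refl (q ⁻¹) y q) ⟩
        (y * q ⁻¹ * q) ^ suc d           ≈⟨ ^-congˡ (suc d) (/-*-cancel q≉0) ⟩
        y ^ suc d                        ≈⟨ y^d≈q^m ⟩
        q ^ℤ m                           ≡⟨ ≡.cong (q ^ℤ_) m≡d+m′ ⟩
        q ^ℤ (+ suc d ℤ.+ m′)            ≈⟨ ^ℤ-+ q≉0 (suc d) m′ ⟩
        q ^ suc d * q ^ℤ m′              ≈⟨ *-comm _ _ ⟩
        q ^ℤ m′ * q ^ suc d              ∎)
      where
      open ≤-Reasoning
      m′ = -[1+ d ] ℤ.+ m
      m≡d+m′ : m ≡ + suc d ℤ.+ m′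
      m≡d+m′ = ≡.sym (≡.trans (≡.sym (ℤ.+-assoc (+ suc d) -[1+ d ] m))
        (≡.trans (≡.cong (ℤ._+ m) (ℤ.+-inverseʳ (+ suc d))) (ℤ.+-identityˡ m)))

    IsPower-suc : IsPower x y → IsPower (1# + x) (q * y)
    IsPower-suc ((y , Py) , lub) = (q * y , RationalPowers-suc y Py) ,
      lub-scale (proj₁ 0<q) (proj₁ (⁻¹-pos 0<q)) (⁻¹-inverseʳ q≉0) RationalPowers-suc RationalPowers-pred lub

    IsPower-pred : IsPower (1# + x) y → IsPower x (q ⁻¹ * y)
    IsPower-pred ((y , Py) , lub) = (q ⁻¹ * y , RationalPowers-pred y Py) ,
      lub-scale (proj₁ (⁻¹-pos 0<q)) (proj₁ 0<q) (⁻¹-inverseˡ q≉0) RationalPowers-pred RationalPowers-suc lub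

    -- y = q ^ (m / d) and a / b ≤ m / d give a d ≤ b m, hence (y ^ b) ^ d ≤ (q ^ a) ^ d.
    RationalPowers-bound : ∀ a b → 0# ≤ x → fromℕ a ≤ fromℕ b * x → RationalPowers x y → y ^ b ≤ q ^ a
    -- A negative numerator contradicts 0 ≤ x ≤ r.
    RationalPowers-bound {x} {y} a b 0≤x a≤bx (mkℚᵘ -[1+ m ] d , x≤r , _) =
      contradiction (fromℕ-cancel-≤ (suc m) 0 (begin
        M               ≈⟨ +-identityˡ M ⟨
        0# + M          ≤⟨ +-monoˡ-≤ M 0≤-M ⟩
        - M + M         ≈⟨ -‿inverseˡ M ⟩
        0#              ∎)) λ ()
      where
      open ≤-Reasoning
      M = fromℕ (suc m)
      0≤-M : 0# ≤ - M
      0≤-M = *-cancelʳ-≤ (⁻¹-pos (fromℕ-pos d)) (begin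
        0# * fromℕ (suc d) ⁻¹  ≈⟨ zeroˡ _ ⟩
        0#                     ≤⟨ 0≤x ⟩
        x                      ≤⟨ x≤r ⟩
        - M / fromℕ (suc d)    ∎)
    RationalPowers-bound {x} {y} a b 0≤x a≤bx (mkℚᵘ (+ m) d , x≤r , 0<y , y^d≈q^m) =
      ^-cancel-≤ (^-pos 0<y b) (^-pos 0<q a) d (begin
        (y ^ b) ^ suc d   ≈⟨ ^-assocʳ y b (suc d) ⟩
        y ^ (b ℕ.* suc d) ≡⟨ ≡.cong (y ^_) (ℕ.*-comm b (suc d)) ⟩
        y ^ (suc d ℕ.* b) ≈⟨ ^-assocʳ y (suc d) b ⟨
        (y ^ suc d) ^ b   ≈⟨ ^-congˡ b y^d≈q^m ⟩
        (q ^ m) ^ b       ≈⟨ ^-assocʳ q m b ⟩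
        q ^ (m ℕ.* b)     ≤⟨ ^-antitone 0<q (proj₁ q<1) ad≤mb ⟩
        q ^ (a ℕ.* suc d) ≈⟨ ^-assocʳ q a (suc d) ⟨
        (q ^ a) ^ suc d   ∎)
      where
      open ≤-Reasoning
      D = fromℕ (suc d)
      ad≤mb : a ℕ.* suc d ℕ.≤ m ℕ.* b
      ad≤mb = fromℕ-cancel-≤ _ _ (begin
        fromℕ (a ℕ.* suc d)      ≈⟨ ×1-homo-* a (suc d) ⟩
        fromℕ a * D              ≤⟨ *-monoˡ-≤ (fromℕ-≥0 (suc d)) a≤bx ⟩
        fromℕ b * x * D          ≤⟨ *-monoˡ-≤ (fromℕ-≥0 (suc d)) (*-monoʳ-≤ (fromℕ-≥0 b) x≤r) ⟩
        fromℕ b * (fromℕ m / D) * D  ≈⟨ *-assoc (fromℕ b) _ D ⟩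
        fromℕ b * (fromℕ m / D * D)  ≈⟨ *-congˡ (/-*-cancel (fromℕ-≉0 (suc d))) ⟩
        fromℕ b * fromℕ m        ≈⟨ *-comm _ _ ⟩
        fromℕ m * fromℕ b        ≈⟨ ×1-homo-* m b ⟨
        fromℕ (m ℕ.* b)          ∎)

    -- Provides the boundedness that `sup-isLub` asks for; it is the general bound for the fraction
    -- 0/1.
    RationalPowers-≤1 : 0# ≤ x → IsUpperBound (RationalPowers x) 1#
    RationalPowers-≤1 {x} 0≤x y Py = ≤-trans (≤-reflexive (sym (*-identityʳ y)))
      (RationalPowers-bound 0 1 0≤x (*-nonneg (fromℕ-≥0 1) 0≤x) Py)

    RationalPowers-fromℕ : ∀ n → x ≤ fromℕ n → RationalPowers x (q ^ n)
    RationalPowers-fromℕ {x} n x≤n = mkℚᵘ (+ n) 0 , ≤-trans x≤n (≤-reflexive n≈n/1) , ^-pos 0<q n , *-identityʳ _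
      where
      n≈n/1 : fromℕ n ≈ fromℕ n / fromℕ 1
      n≈n/1 = trans (sym (*-/-cancel (fromℕ-≉0 1))) (*-congʳ (trans (*-congˡ (+-identityʳ 1#)) (*-identityʳ _)))

    IsPower-fromℕ : ∀ n → IsPower (fromℕ n) (q ^ n)
    -- At exponent 0 the upper bound 1 is attained, by r = 0, so it is a maximum.
    IsPower-fromℕ zero = (1# , 1∈P) , RationalPowers-≤1 ≤-refl , λ b b-ub → b-ub 1# 1∈P
      where
      1∈P : RationalPowers 0# 1#
      1∈P = RationalPowers-fromℕ 0 ≤-refl
    IsPower-fromℕ (suc n) = IsPower-suc (IsPower-fromℕ n)

    IsPower-unit : 0# ≤ x → x ≤ 1# → IsPower x (q ^ℝ x)
    IsPower-unit {x} 0≤x x≤1 = inhabited , sup-isLub _ inhabited (1# , RationalPowers-≤1 0≤x)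
      where
      inhabited : ∃ (RationalPowers x)
      inhabited = q ^ 1 , RationalPowers-fromℕ 1 (≤-trans x≤1 (≤-reflexive (sym (+-identityʳ 1#))))

    -- Below 0 the bound by 1 fails, so existence of the supremum descends from x one unit at a
    -- time.
    IsPower-minus : IsPower x y → ∀ n → ∃[ s ] (IsPower (x - fromℕ n) s × q ^ n * s ≈ y)
    IsPower-minus {x} {y} pow zero = y , IsPower-respˡ (sym x-0≈x) pow , *-identityˡ y
      where
      open ≈-Reasoning
      x-0≈x : x - 0# ≈ x
      x-0≈x = begin
        x - 0#       ≈⟨ +-identityʳ _ ⟨
        x - 0# + 0#  ≈⟨ //-rightDividesˡ 0# x ⟩
        x            ∎
    IsPower-minus {x} {y} pow (suc n) with IsPower-minus pow n
    ... | s , power-s , q^n*s≈y = q ⁻¹ * s , IsPower-pred (IsPower-respˡ x-n≈1+[x-[1+n]] power-s) , (begin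
        q * q ^ n * (q ⁻¹ * s)    ≈⟨ solve 4 (λ q p i s → q :* p :* (i :* s) := p :* (s :* i :* q)) refl q (q ^ n) (q ⁻¹) s ⟩
        q ^ n * (s / q * q)       ≈⟨ *-congˡ (/-*-cancel q≉0) ⟩
        q ^ n * s                 ≈⟨ q^n*s≈y ⟩
        y                         ∎)
      where
      open ≈-Reasoning
      x-n≈1+[x-[1+n]] : x - fromℕ n ≈ 1# + (x - fromℕ (suc n))
      x-n≈1+[x-[1+n]] = begin
        x - fromℕ n                  ≈⟨ +-congˡ (x-[x+y]≈-y 1# (fromℕ n)) ⟨
        x + (1# - fromℕ (suc n))     ≈⟨ solve 3 (λ x o m → x :+ (o :+ m) := o :+ (x :+ m)) refl x 1# (- fromℕ (suc n)) ⟩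
        1# + (x - fromℕ (suc n))     ∎

    ^ℝ-fromℕ : ∀ n → q ^ℝ fromℕ n ≈ q ^ n
    ^ℝ-fromℕ n = IsPower⇒^ℝ (IsPower-fromℕ n)

    ^ℝ-minus : 0# ≤ x → x ≤ 1# → ∀ n → q ^ n * q ^ℝ (x - fromℕ n) ≈ q ^ℝ x
    ^ℝ-minus 0≤x x≤1 n with IsPower-minus (IsPower-unit 0≤x x≤1) n
    ... | s , pow , q^n*s≈q^x = trans (*-congˡ (IsPower⇒^ℝ pow)) q^n*s≈q^x

    ^ℝ-≤1 : 0# ≤ x → x ≤ 1# → q ^ℝ x ≤ 1#
    ^ℝ-≤1 0≤x x≤1 = proj₂ (proj₂ (IsPower-unit 0≤x x≤1)) 1# (RationalPowers-≤1 0≤x)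

    -- For x ≥ 1/2 each y = q ^ r with r ≥ x has 2 y ≤ 1 + y² ≤ 1 + q.
    ^ℝ-half-≉1 : 0# ≤ x → x ≤ 1# → 1# ≤ x + x → q ^ℝ x ≉ 1#
    ^ℝ-half-≉1 {x} 0≤x x≤1 1≤2x q^x≈1 = proj₂ q<1 (antisym (proj₁ q<1) (+-cancelʳ-≤ 1# (begin
        1# + 1#                ≈⟨ 2*x≈x+x 1# ⟨
        fromℕ 2 * 1#           ≈⟨ *-congˡ q^x≈1 ⟨
        fromℕ 2 * q ^ℝ x       ≈⟨ *-comm _ _ ⟩
        q ^ℝ x * fromℕ 2       ≤⟨ *-monoˡ-≤ (fromℕ-≥0 2) (least _ ub) ⟩
        (q + 1#) / fromℕ 2 * fromℕ 2  ≈⟨ /-*-cancel (fromℕ-≉0 2) ⟩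
        q + 1#                 ∎)))
      where
      open ≤-Reasoning
      least = proj₂ (proj₂ (IsPower-unit 0≤x x≤1))

      2*x≈x+x : ∀ x → fromℕ 2 * x ≈ x + x
      2*x≈x+x x = trans (*-congʳ (+-congˡ (+-identityʳ 1#)))
        (trans (distribʳ x 1# 1#) (+-cong (*-identityˡ x) (*-identityˡ x)))

      2y≤1+y² : ∀ y → y ≤ 1# → y + y ≤ y * y + 1#
      2y≤1+y² y y≤1 = begin
        y + y                                ≈⟨ +-identityˡ _ ⟨
        0# + (y + y)                         ≤⟨ +-monoˡ-≤ (y + y) 0≤n² ⟩
        n * n + (y + y)                      ≈⟨ +-congˡ (+-cong (*-identityˡ y) (*-identityˡ y)) ⟨
        -- Replacing every 1 by `n + y` turns the expansion of the square of 1 - y into an identity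
        -- without subtraction, fit for a semiring solver.
        n * n + (1# * y + 1# * y)            ≈⟨ +-congˡ (+-cong (*-congʳ n+y≈1) (*-congʳ n+y≈1)) ⟨
        n * n + ((n + y) * y + (n + y) * y)  ≈⟨ solve 2 (λ n y → n :* n :+ ((n :+ y) :* y :+ (n :+ y) :* y) := y :* y :+ (n :+ y) :* (n :+ y)) refl n y ⟩
        y * y + (n + y) * (n + y)            ≈⟨ +-congˡ (*-cong n+y≈1 n+y≈1) ⟩
        y * y + 1# * 1#                      ≈⟨ +-congˡ (*-identityˡ 1#) ⟩
        y * y + 1#                           ∎
        where
        n = 1# - y
        n+y≈1 : n + y ≈ 1#
        n+y≈1 = //-rightDividesˡ y 1#
        0≤n² : 0# ≤ n * n
        0≤n² = *-nonneg (x≤y⇒0≤y-x y≤1) (x≤y⇒0≤y-x y≤1)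

      1≤2*x : fromℕ 1 ≤ fromℕ 2 * x
      1≤2*x = begin
        fromℕ 1      ≈⟨ +-identityʳ 1# ⟩
        1#           ≤⟨ 1≤2x ⟩
        x + x        ≈⟨ 2*x≈x+x x ⟨
        fromℕ 2 * x  ∎

      ub : IsUpperBound (RationalPowers x) ((q + 1#) / fromℕ 2)
      ub y Py = *-cancelʳ-≤ (fromℕ-pos 1) (begin
        y * fromℕ 2   ≈⟨ *-comm y _ ⟩
        fromℕ 2 * y   ≈⟨ 2*x≈x+x y ⟩
        y + y         ≤⟨ 2y≤1+y² y (RationalPowers-≤1 0≤x y Py) ⟩
        y * y + 1#    ≈⟨ +-congʳ (*-congˡ (*-identityʳ y)) ⟨
        -- The hypothesis x ≥ 1/2 enters here, as the fraction 1/2 in the bound y² ≤ q.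
        y ^ 2 + 1#    ≤⟨ +-monoˡ-≤ 1# (RationalPowers-bound 1 2 0≤x 1≤2*x Py) ⟩
        q ^ 1 + 1#    ≈⟨ +-congʳ (*-identityʳ q) ⟩
        q + 1#        ≈⟨ /-*-cancel (fromℕ-≉0 2) ⟨
        (q + 1#) / fromℕ 2 * fromℕ 2  ∎)

-- Modified Bernstein polynomials

nCk*k!*[n∸k]!≡n! : ∀ {n k} → k ℕ.≤ n → (n C k) ℕ.* (k ! ℕ.* (n ∸ k) !) ≡ n !
nCk*k!*[n∸k]!≡n! {n} {k} k≤n =
  ≡.trans (≡.cong (ℕ._* (k ! ℕ.* (n ∸ k) !)) (nCk≡n!/k![n-k]! k≤n)) (m/n*n≡m (k![n∸k]!∣n! k≤n))
  where instance _ = k ℕ.!* (n ∸ k) !≢0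

-- With n = i + m and k = i + j, both sides become (i + m)! after multiplication by i! j! (m - j)!.
kCi*nCk≡[n∸i]C[k∸i]*nCi : ∀ i {j m} → j ℕ.≤ m →
  ((i ℕ.+ j) C i) ℕ.* ((i ℕ.+ m) C (i ℕ.+ j)) ≡ (m C j) ℕ.* ((i ℕ.+ m) C i)
kCi*nCk≡[n∸i]C[k∸i]*nCi i {j} {m} j≤m = ℕ.*-cancelʳ-≡ _ _ (i ! ℕ.* (j ! ℕ.* (m ∸ j) !)) (begin
  kCi ℕ.* nCk ℕ.* (i ! ℕ.* (j ! ℕ.* (m ∸ j) !))
    ≡⟨ solve 5 (λ c d i j l → c :* d :* (i :* (j :* l)) := d :* (c :* (i :* j) :* l)) ≡.refl kCi nCk (i !) (j !) ((m ∸ j) !) ⟩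
  nCk ℕ.* (kCi ℕ.* (i ! ℕ.* j !) ℕ.* (m ∸ j) !)
    ≡⟨ ≡.cong (λ f → nCk ℕ.* (f ℕ.* (m ∸ j) !)) kCi-factorials ⟩
  nCk ℕ.* ((i ℕ.+ j) ! ℕ.* (m ∸ j) !)
    ≡⟨ nCk-factorials ⟩
  (i ℕ.+ m) !
    ≡⟨ nCi-factorials ⟨
  nCi ℕ.* (i ! ℕ.* m !)
    ≡⟨ ≡.cong (λ f → nCi ℕ.* (i ! ℕ.* f)) (nCk*k!*[n∸k]!≡n! j≤m) ⟨
  nCi ℕ.* (i ! ℕ.* ((m C j) ℕ.* (j ! ℕ.* (m ∸ j) !)))
    ≡⟨ solve 4 (λ n i c f → n :* (i :* (c :* f)) := c :* n :* (i :* f)) ≡.refl nCi (i !) (m C j) (j ! ℕ.* (m ∸ j) !) ⟩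
  (m C j) ℕ.* nCi ℕ.* (i ! ℕ.* (j ! ℕ.* (m ∸ j) !)) ∎)
  where
  open +-*-Solver
  open ≡.≡-Reasoning
  instance _ = ℕ.m*n≢0 (i !) (j ! ℕ.* (m ∸ j) !) {{i ℕ.!≢0}} {{j ℕ.!* (m ∸ j) !≢0}}
  kCi = (i ℕ.+ j) C i
  nCk = (i ℕ.+ m) C (i ℕ.+ j)
  nCi = (i ℕ.+ m) C i
  kCi-factorials : kCi ℕ.* (i ! ℕ.* j !) ≡ (i ℕ.+ j) !
  kCi-factorials = ≡.trans (≡.cong (λ l → kCi ℕ.* (i ! ℕ.* l !)) (≡.sym (ℕ.m+n∸m≡n i j))) (nCk*k!*[n∸k]!≡n! (ℕ.m≤m+n i j))
  nCk-factorials : nCk ℕ.* ((i ℕ.+ j) ! ℕ.* (m ∸ j) !) ≡ (i ℕ.+ m) !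
  nCk-factorials = ≡.trans (≡.cong (λ l → nCk ℕ.* ((i ℕ.+ j) ! ℕ.* l !)) (≡.sym (ℕ.[m+n]∸[m+o]≡n∸o i m j)))
    (nCk*k!*[n∸k]!≡n! (ℕ.+-monoʳ-≤ i j≤m))
  nCi-factorials : nCi ℕ.* (i ! ℕ.* m !) ≡ (i ℕ.+ m) !
  nCi-factorials = ≡.trans (≡.cong (λ l → nCi ℕ.* (i ! ℕ.* l !)) (≡.sym (ℕ.m+n∸m≡n i m))) (nCk*k!*[n∸k]!≡n! (ℕ.m≤m+n i m))

-- Finite sums over intervals of indices

module Sums (R : CompleteOrderedField) where
  open CompleteOrderedField R
  open FieldProperties R
  open import Algebra.Properties.Semiring.Sum semiring using (*-distribˡ-sum; ∑-distrib-+)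

  ∑-cong : ∀ n {f g} → (∀ j → j ℕ.≤ n → f j ≈ g j) → ∑[ 0 ⋯ n ] f ≈ ∑[ 0 ⋯ n ] g
  ∑-cong zero    f≈g = +-congʳ (f≈g 0 z≤n)
  ∑-cong (suc n) f≈g = +-cong (f≈g 0 z≤n) (∑-cong n λ j j≤n → f≈g (suc j) (s≤s j≤n))

  -- `sum` unfolds at its first term, while the inductions on partial sums grow at the last.
  ∑-last : ∀ n f → ∑[ 0 ⋯ suc n ] f ≈ ∑[ 0 ⋯ n ] f + f (suc n)
  ∑-last zero    f = trans (+-congˡ (+-identityʳ _)) (+-congʳ (sym (+-identityʳ _)))
  ∑-last (suc n) f = trans (+-congˡ (∑-last n (f ∘ suc))) (sym (+-assoc _ _ _))

  ∑-zero : ∀ n {f} → (∀ j → j ℕ.≤ n → f j ≈ 0#) → ∑[ 0 ⋯ n ] f ≈ 0#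
  ∑-zero zero    f≈0 = trans (+-congʳ (f≈0 0 z≤n)) (+-identityˡ 0#)
  ∑-zero (suc n) f≈0 = trans (+-cong (f≈0 0 z≤n) (∑-zero n λ j j≤n → f≈0 (suc j) (s≤s j≤n))) (+-identityˡ 0#)

  ∑-single : ∀ {k n} f → k ℕ.≤ n → (∀ j → j ℕ.≤ n → j ≢ k → f j ≈ 0#) → ∑[ 0 ⋯ n ] f ≈ f k
  ∑-single {zero} {zero}  f z≤n f≈0 = +-identityʳ (f 0)
  ∑-single {zero} {suc n} f z≤n f≈0 =
    trans (+-congˡ (∑-zero n λ j j≤n → f≈0 (suc j) (s≤s j≤n) λ ())) (+-identityʳ (f 0))
  ∑-single {suc k} {suc n} f (s≤s k≤n) f≈0 = trans
    (+-cong (f≈0 0 z≤n λ ()) (∑-single (f ∘ suc) k≤n λ j j≤n j≢k → f≈0 (suc j) (s≤s j≤n) (j≢k ∘ ℕ.suc-injective)))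
    (+-identityˡ _)

  ∑-shift : ∀ a n f → ∑[ a ⋯ a ℕ.+ n ] f ≈ ∑[ 0 ⋯ n ] λ j → f (a ℕ.+ j)
  ∑-shift a n f = reflexive (≡.cong (λ l → sum {l} λ j → f (a ℕ.+ toℕ j)) (≡.trans
    (≡.cong (_∸ a) (≡.sym (ℕ.+-suc a n))) (ℕ.m+n∸m≡n a (suc n))))

  ∑-*ˡ : ∀ n c f → c * ∑[ 0 ⋯ n ] f ≈ ∑[ 0 ⋯ n ] λ j → c * f j
  ∑-*ˡ n c f = *-distribˡ-sum {suc n} c (λ j → f (toℕ j))

  ∑-+ : ∀ n f g → ∑[ 0 ⋯ n ] (λ j → f j + g j) ≈ ∑[ 0 ⋯ n ] f + ∑[ 0 ⋯ n ] g
  ∑-+ n f g = ∑-distrib-+ {suc n} (λ j → f (toℕ j)) (λ j → g (toℕ j))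

-- Coefficients of the generating function and the left-hand sum

module Bernstein (R : CompleteOrderedField) (q : CompleteOrderedField.Carrier R) where
  open CompleteOrderedField R
  open FieldProperties R
  open Sums R
  open PowerSeries R
  open QBernstein R q
  open import Algebra.Properties.CommutativeSemiring.Binomial commutativeSemiring using (theorem)
  open import Algebra.Properties.Semiring.Mult semiring using (×-assoc-*; ×-congʳ)
  open import Algebra.Solver.Ring.NaturalCoefficients.Default commutativeSemiring

  t^-diagonal : ∀ k → (t^ k) k ≡ 1#
  t^-diagonal k with k ℕ.≟ k
  ... | yes _  = ≡.refl
  ... | no k≢k = contradiction ≡.refl k≢k

  t^-off-diagonal : ∀ {k n} → n ≢ k → (t^ k) n ≡ 0#
  t^-off-diagonal {k} {n} n≢k with k ℕ.≟ n
  ... | yes k≡n = contradiction (≡.sym k≡n) n≢k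
  ... | no _    = ≡.refl

  t^⊛ : ∀ {k n} f → k ℕ.≤ n → (t^ k ⊛ f) n ≈ f (n ∸ k)
  t^⊛ {k} {n} f k≤n = trans
    (∑-single (λ j → (t^ k) j * f (n ∸ j)) k≤n λ j _ j≢k → trans (*-congʳ (reflexive (t^-off-diagonal j≢k))) (zeroˡ _))
    (trans (*-congʳ (reflexive (t^-diagonal k))) (*-identityˡ _))

  ⊛-const : ∀ f c n → (f ⊛ const c) n ≈ f n * c
  ⊛-const f c n = trans
    (∑-single (λ j → f j * const c (n ∸ j)) ℕ.≤-refl λ j j≤n j≢n →
      trans (*-congˡ (const-pos (ℕ.m<n⇒0<n∸m (ℕ.≤∧≢⇒< j≤n j≢n)))) (zeroʳ _))
    (*-congˡ (reflexive (≡.cong (const c) (ℕ.n∸n≡0 n))))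
    where
    const-pos : ∀ {m} → 0 ℕ.< m → const c m ≈ 0#
    const-pos {suc m} _ = refl

  fromℕ!-≉0 : ∀ n → fromℕ (n !) ≉ 0#
  fromℕ!-≉0 n = fromℕ-≉0 (n !) {{n ℕ.!≢0}}

  binomialTheorem : ∀ a b n → ∑[ 0 ⋯ n ] (λ j → fromℕ (n C j) * (a ^ j * b ^ (n ∸ j))) ≈ (a + b) ^ n
  binomialTheorem a b n = sym (trans (theorem n a b) (∑-cong n {λ j → (n C j) · binomial j} λ j _ → begin
    (n C j) · binomial j           ≈⟨ ×-congʳ (n C j) (*-identityˡ _) ⟨
    (n C j) · (1# * binomial j)    ≈⟨ ×-assoc-* (n C j) 1# (binomial j) ⟨
    fromℕ (n C j) * binomial j     ∎))
    where
    open ≈-Reasoning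
    binomial : ℕ → Carrier
    binomial j = a ^ j * b ^ (n ∸ j)

  -- The binomial coefficient divides (i + m)!, whose image in the ordered field is nonzero.
  nCi≉0 : ∀ i m → fromℕ ((i ℕ.+ m) C i) ≉ 0#
  nCi≉0 i m nCi≈0 = fromℕ!-≉0 (i ℕ.+ m) (begin
    fromℕ ((i ℕ.+ m) !)   ≡⟨ ≡.cong fromℕ (nCk*k!*[n∸k]!≡n! (ℕ.m≤m+n i m)) ⟨
    fromℕ (((i ℕ.+ m) C i) ℕ.* _)  ≈⟨ ×1-homo-* ((i ℕ.+ m) C i) _ ⟩
    fromℕ ((i ℕ.+ m) C i) * _      ≈⟨ *-congʳ nCi≈0 ⟩
    0# * _                ≈⟨ zeroˡ _ ⟩
    0#                    ∎)
    where open ≈-Reasoning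

  module _ (B : ℕ → ℕ → Carrier → Carrier) (isB : IsModifiedBernstein B)
           (x : Carrier) (0≤x : 0# ≤ x) (x≤1 : x ≤ 1#) where

    -- The coefficient at t^n is b^(n-k)/(n-k)! times a^k/k!; multiplying by n! leaves the binomial
    -- coefficient.
    modifiedBernstein : ∀ {k n} → k ℕ.≤ n → B k n x ≈ fromℕ (n C k) * ([ x ] ^ k * [ 1# - x ] ^ (n ∸ k))
    modifiedBernstein {k} {n} k≤n = begin
      B k n x                             ≈⟨ /-*-cancel (fromℕ!-≉0 n) ⟨
      B k n x / n!f * n!f                 ≈⟨ *-congʳ (isB k x 0≤x x≤1 n) ⟨
      bernsteinSeries k x n * n!f         ≈⟨ *-congʳ (⊛-const (t^ k ⊛ exp[ b t]) _ n) ⟩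
      (t^ k ⊛ exp[ b t]) n * (a ^ k / k!f) * n!f
        ≈⟨ *-congʳ (*-congʳ (t^⊛ exp[ b t] k≤n)) ⟩
      b ^ (n ∸ k) / l!f * (a ^ k / k!f) * n!f
        ≈⟨ *-congˡ n!-split ⟩
      b ^ (n ∸ k) / l!f * (a ^ k / k!f) * (nCk * (k!f * l!f))
        ≈⟨ solve 7 (λ b l′ a k′ c k l → b :* l′ :* (a :* k′) :* (c :* (k :* l)) := c :* (a :* k′ :* k :* (b :* l′ :* l)))
             refl (b ^ (n ∸ k)) (l!f ⁻¹) (a ^ k) (k!f ⁻¹) nCk k!f l!f ⟩
      nCk * (a ^ k / k!f * k!f * (b ^ (n ∸ k) / l!f * l!f))
        ≈⟨ *-congˡ (*-cong (/-*-cancel (fromℕ!-≉0 k)) (/-*-cancel (fromℕ!-≉0 (n ∸ k)))) ⟩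
      nCk * (a ^ k * b ^ (n ∸ k))         ∎
      where
      open ≈-Reasoning
      a   = [ x ]
      b   = [ 1# - x ]
      n!f = fromℕ (n !)
      k!f = fromℕ (k !)
      l!f = fromℕ ((n ∸ k) !)
      nCk = fromℕ (n C k)
      n!-split : n!f ≈ nCk * (k!f * l!f)
      n!-split = begin
        fromℕ (n !)                               ≡⟨ ≡.cong fromℕ (nCk*k!*[n∸k]!≡n! k≤n) ⟨
        fromℕ ((n C k) ℕ.* (k ! ℕ.* (n ∸ k) !))   ≈⟨ ×1-homo-* (n C k) _ ⟩
        nCk * fromℕ (k ! ℕ.* (n ∸ k) !)           ≈⟨ *-congˡ (×1-homo-* (k !) _) ⟩
        nCk * (k!f * l!f)                         ∎

    -- Here `suc i` is the index i of the theorem. Each term with k = `suc i` + j is a^(i+1) times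
    -- term j of the binomial expansion of (a + b)^m.
    bernsteinSum : ∀ i m → let n = suc i ℕ.+ m in
      ∑[ i ⋯ n ] (λ k → (fromℕ (k C suc i) / fromℕ (n C suc i)) * B k n x)
      ≈ [ x ] ^ suc i * ([ x ] + [ 1# - x ]) ^ m
    bernsteinSum i m = begin
      ∑[ i ⋯ n ] f                           ≡⟨ ≡.cong (λ l → ∑[ i ⋯ l ] f) (ℕ.+-suc i m) ⟨
      ∑[ i ⋯ i ℕ.+ suc m ] f                 ≈⟨ ∑-shift i (suc m) f ⟩
      f (i ℕ.+ 0) + ∑[ 0 ⋯ m ] (λ j → f (i ℕ.+ suc j))
        ≈⟨ +-cong f[i]≈0 (∑-cong m f[1+i+j]) ⟩
      0# + ∑[ 0 ⋯ m ] (λ j → a ^ suc i * (fromℕ (m C j) * (a ^ j * b ^ (m ∸ j))))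
        ≈⟨ +-identityˡ _ ⟩
      ∑[ 0 ⋯ m ] (λ j → a ^ suc i * (fromℕ (m C j) * (a ^ j * b ^ (m ∸ j))))
        ≈⟨ ∑-*ˡ m (a ^ suc i) (λ j → fromℕ (m C j) * (a ^ j * b ^ (m ∸ j))) ⟨
      a ^ suc i * ∑[ 0 ⋯ m ] (λ j → fromℕ (m C j) * (a ^ j * b ^ (m ∸ j)))
        ≈⟨ *-congˡ (binomialTheorem a b m) ⟩
      a ^ suc i * (a + b) ^ m                ∎
      where
      open ≈-Reasoning
      n = suc i ℕ.+ m
      a = [ x ]
      b = [ 1# - x ]
      nCi = fromℕ (n C suc i)
      f : ℕ → Carrier
      f k = (fromℕ (k C suc i) / nCi) * B k n x
      -- The sum starts one place below `suc i`, where the binomial coefficient `k C suc i`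
      -- vanishes.
      f[i]≈0 : f (i ℕ.+ 0) ≈ 0#
      f[i]≈0 = begin
        (fromℕ ((i ℕ.+ 0) C suc i) / nCi) * _  ≡⟨ ≡.cong (λ c → (fromℕ c / nCi) * B (i ℕ.+ 0) n x)
          (k>n⇒nCk≡0 (s≤s (ℕ.≤-reflexive (ℕ.+-identityʳ i)))) ⟩
        (0# / nCi) * _                         ≈⟨ *-congʳ (zeroˡ _) ⟩
        0# * _                                 ≈⟨ zeroˡ _ ⟩
        0#                                     ∎
      f[1+i+j] : ∀ j → j ℕ.≤ m → f (i ℕ.+ suc j) ≈ a ^ suc i * (fromℕ (m C j) * (a ^ j * b ^ (m ∸ j)))
      f[1+i+j] j j≤m = begin
        f (i ℕ.+ suc j)             ≡⟨ ≡.cong f (ℕ.+-suc i j) ⟩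
        kCi / nCi * B k n x         ≈⟨ *-congˡ (modifiedBernstein (ℕ.+-monoʳ-≤ (suc i) j≤m)) ⟩
        kCi / nCi * (nCk * (a ^ k * b ^ (n ∸ k)))
          ≈⟨ *-congˡ (*-congˡ (*-cong (^-homo-* a (suc i) j) (reflexive (≡.cong (b ^_) (ℕ.[m+n]∸[m+o]≡n∸o (suc i) m j))))) ⟩
        kCi / nCi * (nCk * (a ^ suc i * a ^ j * b ^ (m ∸ j)))
          ≈⟨ solve 6 (λ c n′ d x y z → c :* n′ :* (d :* (x :* y :* z)) := x :* (c :* d :* n′ :* (y :* z)))
               refl kCi (nCi ⁻¹) nCk (a ^ suc i) (a ^ j) (b ^ (m ∸ j)) ⟩
        a ^ suc i * (kCi * nCk / nCi * (a ^ j * b ^ (m ∸ j)))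
          ≈⟨ *-congˡ (*-congʳ (*-congʳ kCi*nCk)) ⟩
        a ^ suc i * (fromℕ (m C j) * nCi / nCi * (a ^ j * b ^ (m ∸ j)))
          ≈⟨ *-congˡ (*-congʳ (*-/-cancel (nCi≉0 (suc i) m))) ⟩
        a ^ suc i * (fromℕ (m C j) * (a ^ j * b ^ (m ∸ j)))  ∎
        where
        k = suc i ℕ.+ j
        kCi = fromℕ (k C suc i)
        nCk = fromℕ (n C k)
        kCi*nCk : kCi * nCk ≈ fromℕ (m C j) * nCi
        kCi*nCk = begin
          kCi * nCk                         ≈⟨ ×1-homo-* (k C suc i) (n C k) ⟨
          fromℕ ((k C suc i) ℕ.* (n C k))     ≡⟨ ≡.cong fromℕ (kCi*nCk≡[n∸i]C[k∸i]*nCi (suc i) j≤m) ⟩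
          fromℕ ((m C j) ℕ.* (n C suc i))     ≈⟨ ×1-homo-* (m C j) (n C suc i) ⟩
          fromℕ (m C j) * nCi               ∎

-- Gaussian binomials and q-Stirling numbers

[1+n]C2≡nC2+n : ∀ n → suc n C 2 ≡ n C 2 ℕ.+ n
[1+n]C2≡nC2+n n = ≡.trans (≡.sym (nCk+nC[k+1]≡[n+1]C[k+1] n 1))
  (≡.trans (≡.cong (ℕ._+ n C 2) (nC1≡n n)) (ℕ.+-comm n (n C 2)))

module QStirling (R : CompleteOrderedField) (q : CompleteOrderedField.Carrier R)
  (0<q : CompleteOrderedField._<_ R (CompleteOrderedField.0# R) q)
  (q<1 : CompleteOrderedField._<_ R q (CompleteOrderedField.1# R)) where
  open CompleteOrderedField R
  open FieldProperties R
  open RealPower R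
  open Sums R
  open QBernstein R q
  open import Algebra.Solver.Ring.NaturalCoefficients.Default commutativeSemiring

  private
    variable
      x y z : Carrier

  1-q≉0 : 1# - q ≉ 0#
  1-q≉0 1-q≈0 = proj₂ q<1 (sym (x-y≈0⇒x≈y 1# q 1-q≈0))

  [n]≈ : ∀ n → [ fromℕ n ] ≈ (1# - q ^ n) / (1# - q)
  [n]≈ n = *-congʳ (+-congˡ (-‿cong (^ℝ-fromℕ q 0<q q<1 n)))

  [0]≈0 : [ fromℕ 0 ] ≈ 0#
  [0]≈0 = trans ([n]≈ 0) (trans (*-congʳ (-‿inverseʳ 1#)) (zeroˡ _))

  [1+n]≉0 : ∀ n → [ fromℕ (suc n) ] ≉ 0#
  [1+n]≉0 n [1+n]≈0 = proj₂ q<1 (antisym (proj₁ q<1) (begin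
    1#           ≈⟨ x-y≈0⇒x≈y 1# (q ^ suc n) 1-q^n≈0 ⟩
    q ^ suc n    ≤⟨ ^-antitone 0<q (proj₁ q<1) (s≤s (z≤n {n})) ⟩
    q ^ 1        ≈⟨ *-identityʳ q ⟩
    q            ∎))
    where
    open ≤-Reasoning
    1-q^n≈0 : 1# - q ^ suc n ≈ 0#
    1-q^n≈0 = begin-equality
      1# - q ^ suc n                         ≈⟨ /-*-cancel 1-q≉0 ⟨
      (1# - q ^ suc n) / (1# - q) * (1# - q) ≈⟨ *-congʳ ([n]≈ (suc n)) ⟨
      [ fromℕ (suc n) ] * (1# - q)           ≈⟨ *-congʳ [1+n]≈0 ⟩
      0# * (1# - q)                          ≈⟨ zeroˡ _ ⟩
      0#                                     ∎

  -- Common source of the addition laws for real and for natural arguments: y and z are powers of q,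
  -- and w is 1/(1-q).
  1-yz-split : ∀ w → x ≈ y * z → (1# - x) * w ≈ (1# - y) * w + y * ((1# - z) * w)
  1-yz-split {x} {y} {z} w x≈yz = sym (begin
    (1# - y) * w + y * ((1# - z) * w)  ≈⟨ +-congˡ (*-assoc y _ w) ⟨
    (1# - y) * w + y * (1# - z) * w    ≈⟨ distribʳ w _ _ ⟨
    (1# - y + y * (1# - z)) * w        ≈⟨ *-congʳ (+-congˡ (x[y-z]≈xy-xz y 1# z)) ⟩
    (1# - y + (y * 1# - y * z)) * w    ≈⟨ *-congʳ (+-congˡ (+-cong (*-identityʳ y) (-‿cong (sym x≈yz)))) ⟩
    (1# - y + (y - x)) * w             ≈⟨ *-congʳ (+-assoc (1# - y) y (- x)) ⟨
    (1# - y + y - x) * w               ≈⟨ *-congʳ (+-congʳ (//-rightDividesˡ y 1#)) ⟩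
    (1# - x) * w                       ∎)
    where open ≈-Reasoning

  [x]-split : 0# ≤ x → x ≤ 1# → ∀ k → [ x ] ≈ [ fromℕ k ] + q ^ k * [ x - fromℕ k ]
  [x]-split 0≤x x≤1 k = trans (1-yz-split _ (sym (^ℝ-minus q 0<q q<1 0≤x x≤1 k))) (+-congʳ (sym ([n]≈ k)))

  [m+n]-split : ∀ m n {k} → k ≡ m ℕ.+ n → [ fromℕ k ] ≈ [ fromℕ m ] + q ^ m * [ fromℕ n ]
  [m+n]-split m n ≡.refl = begin
    [ fromℕ (m ℕ.+ n) ]                ≈⟨ [n]≈ (m ℕ.+ n) ⟩
    (1# - q ^ (m ℕ.+ n)) / (1# - q)    ≈⟨ 1-yz-split _ (^-homo-* q m n) ⟩
    (1# - q ^ m) / (1# - q) + q ^ m * ((1# - q ^ n) / (1# - q)) ≈⟨ +-cong ([n]≈ m) (*-congˡ ([n]≈ n)) ⟨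
    [ fromℕ m ] + q ^ m * [ fromℕ n ]  ∎
    where open ≈-Reasoning

  [n]!≉0 : ∀ n → [ n ]! ≉ 0#
  [n]!≉0 zero    = 1≉0
  [n]!≉0 (suc n) = *-≉0 ([1+n]≉0 n) ([n]!≉0 n)

  q^[1+n]C2 : ∀ n → q ^ (suc n C 2) ≈ q ^ (n C 2) * q ^ n
  q^[1+n]C2 n = trans (reflexive (≡.cong (q ^_) ([1+n]C2≡nC2+n n))) (^-homo-* q (n C 2) n)

  -- With denominators cleared and `l` in place of `k ∸ j`, identities between Gaussian binomials
  -- follow by cancelling q-factorials.
  gaussBinomial-! : ∀ j l {k} → k ≡ j ℕ.+ l → gaussBinomial k j * ([ j ]! * [ l ]!) ≈ [ k ]!
  gaussBinomial-! j l ≡.refl = begin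
    gaussBinomial (j ℕ.+ l) j * ([ j ]! * [ l ]!)              ≡⟨ ≡.cong (λ i → gaussBinomial (j ℕ.+ l) j * ([ j ]! * [ i ]!)) (ℕ.m+n∸m≡n j l) ⟨
    gaussBinomial (j ℕ.+ l) j * ([ j ]! * [ j ℕ.+ l ∸ j ]!)    ≈⟨ /-*-cancel (*-≉0 ([n]!≉0 j) ([n]!≉0 (j ℕ.+ l ∸ j))) ⟩
    [ j ℕ.+ l ]!                                               ∎
    where open ≈-Reasoning

  gaussBinomial-0 : ∀ k → gaussBinomial k 0 ≈ 1#
  gaussBinomial-0 k = *-cancelʳ-≉0 ([n]!≉0 k) (trans (*-congˡ (sym (*-identityˡ _)))
    (trans (gaussBinomial-! 0 k ≡.refl) (sym (*-identityˡ _))))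

  gaussBinomial-n : ∀ k → gaussBinomial k k ≈ 1#
  gaussBinomial-n k = *-cancelʳ-≉0 ([n]!≉0 k) (trans (*-congˡ (sym (*-identityʳ _)))
    (trans (gaussBinomial-! k 0 (≡.sym (ℕ.+-identityʳ k))) (sym (*-identityˡ _))))

  gaussBinomial-absorb : ∀ {j k} → j ℕ.≤ k →
    [ fromℕ (suc j) ] * gaussBinomial (suc k) (suc j) ≈ [ fromℕ (suc k) ] * gaussBinomial k j
  gaussBinomial-absorb {j} {k} j≤k = *-cancelʳ-≉0 (*-≉0 ([n]!≉0 j) ([n]!≉0 (k ∸ j))) (begin
    [ fromℕ (suc j) ] * gaussBinomial (suc k) (suc j) * ([ j ]! * [ k ∸ j ]!)
      ≈⟨ solve 4 (λ s g j l → s :* g :* (j :* l) := g :* (s :* j :* l)) refl [ fromℕ (suc j) ] (gaussBinomial (suc k) (suc j)) [ j ]! [ k ∸ j ]! ⟩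
    gaussBinomial (suc k) (suc j) * ([ suc j ]! * [ k ∸ j ]!)
      ≈⟨ gaussBinomial-! (suc j) (k ∸ j) (≡.cong suc k≡j+[k∸j]) ⟩
    [ fromℕ (suc k) ] * [ k ]!
      ≈⟨ *-congˡ (gaussBinomial-! j (k ∸ j) k≡j+[k∸j]) ⟨
    [ fromℕ (suc k) ] * (gaussBinomial k j * ([ j ]! * [ k ∸ j ]!))
      ≈⟨ *-assoc _ _ _ ⟨
    [ fromℕ (suc k) ] * gaussBinomial k j * ([ j ]! * [ k ∸ j ]!) ∎)
    where
    open ≈-Reasoning
    k≡j+[k∸j] : k ≡ j ℕ.+ (k ∸ j)
    k≡j+[k∸j] = ≡.sym (ℕ.m+[n∸m]≡n j≤k)

  -- With k = j + 1 + l, the splitting [k+1] = [j+1] + q^(j+1) [l+1] of the top factor of [k+1]!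
  -- produces the two summands.
  gaussBinomial-pascal : ∀ {j k} → j ℕ.< k →
    gaussBinomial (suc k) (suc j) ≈ gaussBinomial k j + q ^ suc j * gaussBinomial k (suc j)
  gaussBinomial-pascal {j} {k} j<k = *-cancelʳ-≉0 (*-≉0 ([n]!≉0 (suc j)) ([n]!≉0 (suc l))) (begin
    gaussBinomial (suc k) (suc j) * ([ suc j ]! * [ suc l ]!)
      ≈⟨ gaussBinomial-! (suc j) (suc l) (≡.cong suc k≡j+[1+l]) ⟩
    [ fromℕ (suc k) ] * [ k ]!
      ≈⟨ *-congʳ ([m+n]-split (suc j) (suc l) (≡.cong suc k≡j+[1+l])) ⟩
    ([1+j] + q ^ suc j * [1+l]) * [ k ]!
      ≈⟨ solve 4 (λ s p t f → (s :+ p :* t) :* f := s :* f :+ p :* t :* f) refl [1+j] (q ^ suc j) [1+l] [ k ]! ⟩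
    [1+j] * [ k ]! + q ^ suc j * [1+l] * [ k ]!
      ≈⟨ +-cong (*-congˡ (gaussBinomial-! j (suc l) k≡j+[1+l])) (*-congˡ (gaussBinomial-! (suc j) l k≡[1+j]+l)) ⟨
    [1+j] * (gaussBinomial k j * ([ j ]! * ([1+l] * [ l ]!)))
      + q ^ suc j * [1+l] * (gaussBinomial k (suc j) * ([1+j] * [ j ]! * [ l ]!))
      ≈⟨ solve 7 (λ s t g h p j l → s :* (g :* (j :* (t :* l))) :+ p :* t :* (h :* (s :* j :* l))
                    := (g :+ p :* h) :* (s :* j :* (t :* l)))
           refl [1+j] [1+l] (gaussBinomial k j) (gaussBinomial k (suc j)) (q ^ suc j) [ j ]! [ l ]! ⟩
    (gaussBinomial k j + q ^ suc j * gaussBinomial k (suc j)) * ([ suc j ]! * [ suc l ]!) ∎)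
    where
    open ≈-Reasoning
    l = k ∸ suc j
    [1+j] = [ fromℕ (suc j) ]
    [1+l] = [ fromℕ (suc l) ]
    k≡[1+j]+l : k ≡ suc j ℕ.+ l
    k≡[1+j]+l = ≡.sym (ℕ.m+[n∸m]≡n j<k)
    k≡j+[1+l] : k ≡ j ℕ.+ suc l
    k≡j+[1+l] = ≡.trans k≡[1+j]+l (≡.sym (ℕ.+-suc j l))

  -- The coefficient of t^j in the product of the factors 1 - q^i t over i < k. For k > 0 it
  -- vanishes at t = 1, as the factor i = 0 does.
  signedGauss : ℕ → ℕ → Carrier
  signedGauss k j = (- 1#) ^ j * q ^ (j C 2) * gaussBinomial k j

  -- S n k = stirlingSum n k / (q ^ (k C 2) [ k ]!)
  stirlingSum : ℕ → ℕ → Carrier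
  stirlingSum n k = ∑[ 0 ⋯ k ] λ j → signedGauss k j * [ fromℕ (k ∸ j) ] ^ n

  x+-1*x≈0 : ∀ x → x + - 1# * x ≈ 0#
  x+-1*x≈0 x = trans (+-congˡ (-1*x≈-x x)) (-‿inverseʳ x)

  -- By q-Pascal the term m + 1 is the difference of the closed forms at m + 1 and m.
  signedGauss-partialSum : ∀ {k} m → m ℕ.≤ k →
    ∑[ 0 ⋯ m ] (signedGauss (suc k)) ≈ (- 1#) ^ m * q ^ (suc m C 2) * gaussBinomial k m
  signedGauss-partialSum {k} zero _ = trans (+-identityʳ _)
    (*-congˡ (trans (gaussBinomial-0 (suc k)) (sym (gaussBinomial-0 k))))
  signedGauss-partialSum {k} (suc m) m<k = begin
    ∑[ 0 ⋯ suc m ] (signedGauss (suc k))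
      ≈⟨ ∑-last m (signedGauss (suc k)) ⟩
    ∑[ 0 ⋯ m ] (signedGauss (suc k)) + - 1# * e * Q * gaussBinomial (suc k) (suc m)
      ≈⟨ +-cong (signedGauss-partialSum m (ℕ.<⇒≤ m<k)) (*-congˡ (gaussBinomial-pascal m<k)) ⟩
    e * Q * g + - 1# * e * Q * (g + p * g′)
      ≈⟨ solve 6 (λ e Q g s p g′ → e :* Q :* g :+ s :* e :* Q :* (g :+ p :* g′)
                    := s :* e :* (Q :* p) :* g′ :+ (e :* Q :* g :+ s :* (e :* Q :* g)))
           refl e Q g (- 1#) p g′ ⟩
    - 1# * e * (Q * p) * g′ + (e * Q * g + - 1# * (e * Q * g))
      ≈⟨ +-cong (*-congʳ (*-congˡ (sym (q^[1+n]C2 (suc m))))) (x+-1*x≈0 (e * Q * g)) ⟩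
    - 1# * e * q ^ (suc (suc m) C 2) * g′ + 0#
      ≈⟨ +-identityʳ _ ⟩
    - 1# * e * q ^ (suc (suc m) C 2) * g′ ∎
    where
    open ≈-Reasoning
    e = (- 1#) ^ m
    Q = q ^ (suc m C 2)
    p = q ^ suc m
    g = gaussBinomial k m
    g′ = gaussBinomial k (suc m)

  stirlingSum-zero : ∀ k → stirlingSum 0 (suc k) ≈ 0#
  stirlingSum-zero k = begin
    stirlingSum 0 (suc k)
      -- At exponent 0 every power is 1, including [0]^0 in the last term.
      ≈⟨ ∑-cong (suc k) {g = signedGauss (suc k)} (λ j _ → *-identityʳ (signedGauss (suc k) j)) ⟩
    ∑[ 0 ⋯ suc k ] (signedGauss (suc k))
      -- The closed form reaches only index k; the remaining term is its negative.
      ≈⟨ ∑-last k (signedGauss (suc k)) ⟩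
    ∑[ 0 ⋯ k ] (signedGauss (suc k)) + signedGauss (suc k) (suc k)
      ≈⟨ +-cong (signedGauss-partialSum k ℕ.≤-refl) refl ⟩
    e * Q * gaussBinomial k k + - 1# * e * Q * gaussBinomial (suc k) (suc k)
      ≈⟨ +-cong (*-congˡ (gaussBinomial-n k)) (*-congˡ (gaussBinomial-n (suc k))) ⟩
    e * Q * 1# + - 1# * e * Q * 1#
      ≈⟨ solve 4 (λ e Q o s → e :* Q :* o :+ s :* e :* Q :* o := e :* Q :* o :+ s :* (e :* Q :* o)) refl e Q 1# (- 1#) ⟩
    e * Q * 1# + - 1# * (e * Q * 1#)
      ≈⟨ x+-1*x≈0 _ ⟩
    0# ∎
    where
    open ≈-Reasoning
    e = (- 1#) ^ k
    Q = q ^ (suc k C 2)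

  -- From [k+1] = [k-j] + q^(k-j) [j+1], summed against the signed Gaussian coefficients;
  -- the negative term is kept on the left so that the rest is a semiring identity.
  stirlingSum-suc′ : ∀ n k → stirlingSum (suc n) (suc k) + - 1# * (q ^ k * [ fromℕ (suc k) ] * stirlingSum n k)
    ≈ [ fromℕ (suc k) ] * stirlingSum n (suc k)
  stirlingSum-suc′ n k = begin
    -- The term `t₀` already contains a factor [k+1]. Term j + 1 of the row `suc k` is paired with
    -- term j of the row `k`.
    t₀ + ∑[ 0 ⋯ k ] t₁ + - 1# * (q ^ k * K * stirlingSum n k)
      ≈⟨ solve 5 (λ t T s c S → t :+ T :+ s :* (c :* S) := t :+ (T :+ s :* c :* S)) refl t₀ (∑[ 0 ⋯ k ] t₁) (- 1#) (q ^ k * K) (stirlingSum n k) ⟩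
    t₀ + (∑[ 0 ⋯ k ] t₁ + - 1# * (q ^ k * K) * stirlingSum n k)
      ≈⟨ +-congˡ (+-congˡ (∑-*ˡ k (- 1# * (q ^ k * K)) t₂)) ⟩
    t₀ + (∑[ 0 ⋯ k ] t₁ + ∑[ 0 ⋯ k ] (λ j → - 1# * (q ^ k * K) * t₂ j))
      ≈⟨ +-congˡ (∑-+ k t₁ (λ j → - 1# * (q ^ k * K) * t₂ j)) ⟨
    t₀ + ∑[ 0 ⋯ k ] (λ j → t₁ j + - 1# * (q ^ k * K) * t₂ j)
      ≈⟨ +-cong (solve 3 (λ c K V → c :* (K :* V) := K :* (c :* V)) refl (signedGauss (suc k) 0) K (K ^ n)) (∑-cong k {g = λ j → K * t₃ j} term) ⟩
    K * (signedGauss (suc k) 0 * K ^ n) + ∑[ 0 ⋯ k ] (λ j → K * t₃ j)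
      ≈⟨ +-congˡ (∑-*ˡ k K t₃) ⟨
    K * (signedGauss (suc k) 0 * K ^ n) + K * ∑[ 0 ⋯ k ] t₃
      ≈⟨ distribˡ K _ _ ⟨
    K * stirlingSum n (suc k) ∎
    where
    open ≈-Reasoning
    K = [ fromℕ (suc k) ]
    t₀ = signedGauss (suc k) 0 * K ^ suc n
    t₁ t₂ t₃ : ℕ → Carrier
    t₁ j = signedGauss (suc k) (suc j) * [ fromℕ (k ∸ j) ] ^ suc n
    t₂ j = signedGauss k j * [ fromℕ (k ∸ j) ] ^ n
    t₃ j = signedGauss (suc k) (suc j) * [ fromℕ (k ∸ j) ] ^ n
    term : ∀ j → j ℕ.≤ k → t₁ j + - 1# * (q ^ k * K) * t₂ j ≈ K * t₃ j
    term j j≤k = begin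
      - 1# * e * q ^ (suc j C 2) * g′ * (L * V) + - 1# * (q ^ k * K) * (e * Q * g * V)
        ≈⟨ +-cong (*-congʳ (*-congʳ (*-congˡ (q^[1+n]C2 j)))) (*-congʳ (*-congˡ (*-congʳ q^k≈q^l*q^j))) ⟩
      - 1# * e * (Q * p) * g′ * (L * V) + - 1# * (r * p * K) * (e * Q * g * V)
        ≈⟨ +-congˡ (solve 8 (λ s r p K e Q g V → s :* (r :* p :* K) :* (e :* Q :* g :* V) := s :* e :* (Q :* p) :* r :* V :* (K :* g))
             refl (- 1#) r p K e Q g V) ⟩
      - 1# * e * (Q * p) * g′ * (L * V) + - 1# * e * (Q * p) * r * V * (K * g)
        -- Absorption gives both products the same Gaussian binomial `g′`, so that [k-j] + q^(k-j)
        -- [j+1] can be collected.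
        ≈⟨ +-congˡ (*-congˡ (gaussBinomial-absorb j≤k)) ⟨
      - 1# * e * (Q * p) * g′ * (L * V) + - 1# * e * (Q * p) * r * V * (J * g′)
        ≈⟨ solve 6 (λ c g′ L V r J → c :* g′ :* (L :* V) :+ c :* r :* V :* (J :* g′) := (L :+ r :* J) :* (c :* g′ :* V))
             refl (- 1# * e * (Q * p)) g′ L V r J ⟩
      (L + r * J) * (- 1# * e * (Q * p) * g′ * V)
        ≈⟨ *-cong ([m+n]-split (k ∸ j) (suc j) 1+k≡l+[1+j]) (*-congʳ (*-congʳ (*-congˡ (q^[1+n]C2 j)))) ⟨
      K * (- 1# * e * q ^ (suc j C 2) * g′ * V) ∎
      where
      e = (- 1#) ^ j
      Q = q ^ (j C 2)
      p = q ^ j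
      r = q ^ (k ∸ j)
      g = gaussBinomial k j
      g′ = gaussBinomial (suc k) (suc j)
      J = [ fromℕ (suc j) ]
      L = [ fromℕ (k ∸ j) ]
      V = L ^ n
      k≡l+j : k ≡ k ∸ j ℕ.+ j
      k≡l+j = ≡.sym (ℕ.m∸n+n≡m j≤k)
      1+k≡l+[1+j] : suc k ≡ k ∸ j ℕ.+ suc j
      1+k≡l+[1+j] = ≡.trans (≡.cong suc k≡l+j) (≡.sym (ℕ.+-suc (k ∸ j) j))
      q^k≈q^l*q^j : q ^ k ≈ r * p
      q^k≈q^l*q^j = trans (reflexive (≡.cong (q ^_) k≡l+j)) (^-homo-* q (k ∸ j) j)

  -- Division by q^C(k+1,2) [k+1]! gives S(n+1,k+1) = S(n,k) + [k+1] S(n,k+1), because C(k+1,2) =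
  -- C(k,2) + k.
  stirlingSum-suc : ∀ n k → stirlingSum (suc n) (suc k)
    ≈ [ fromℕ (suc k) ] * (stirlingSum n (suc k) + q ^ k * stirlingSum n k)
  stirlingSum-suc n k = begin
    A                                   ≈⟨ +-identityʳ A ⟨
    A + 0#                              ≈⟨ +-congˡ (x+-1*x≈0 X) ⟨
    A + (X + - 1# * X)                  ≈⟨ solve 3 (λ a x y → a :+ (x :+ y) := a :+ y :+ x) refl A X (- 1# * X) ⟩
    A + - 1# * X + X                    ≈⟨ +-congʳ (stirlingSum-suc′ n k) ⟩
    K * stirlingSum n (suc k) + X       ≈⟨ solve 4 (λ K S p T → K :* S :+ p :* K :* T := K :* (S :+ p :* T)) refl K (stirlingSum n (suc k)) (q ^ k) (stirlingSum n k) ⟩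
    K * (stirlingSum n (suc k) + q ^ k * stirlingSum n k) ∎
    where
    open ≈-Reasoning
    K = [ fromℕ (suc k) ]
    A = stirlingSum (suc n) (suc k)
    X = q ^ k * K * stirlingSum n k

  -- Both entries on the right of the recurrence again have first index below the second, so the
  -- claim descends to n = 0.
  stirlingSum-vanish : ∀ {n k} → n ℕ.< k → stirlingSum n k ≈ 0#
  stirlingSum-vanish {zero}  {suc k} _         = stirlingSum-zero k
  stirlingSum-vanish {suc n} {suc k} (s≤s n<k) = begin
    stirlingSum (suc n) (suc k)    ≈⟨ stirlingSum-suc n k ⟩
    _ * (stirlingSum n (suc k) + q ^ k * stirlingSum n k)
      ≈⟨ *-congˡ (+-cong (stirlingSum-vanish (ℕ.m<n⇒m<1+n n<k)) (*-congˡ (stirlingSum-vanish n<k))) ⟩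
    _ * (0# + q ^ k * 0#)          ≈⟨ *-congˡ (trans (+-identityˡ _) (zeroʳ _)) ⟩
    _ * 0#                         ≈⟨ zeroʳ _ ⟩
    0#                             ∎
    where open ≈-Reasoning

  stirlingSum-00 : stirlingSum 0 0 ≈ 1#
  stirlingSum-00 = begin
    1# * 1# * gaussBinomial 0 0 * 1# + 0#  ≈⟨ +-identityʳ _ ⟩
    1# * 1# * gaussBinomial 0 0 * 1#       ≈⟨ *-identityʳ _ ⟩
    1# * 1# * gaussBinomial 0 0            ≈⟨ *-cong (*-identityˡ 1#) (gaussBinomial-0 0) ⟩
    1# * 1#                                ≈⟨ *-identityˡ 1# ⟩
    1#                                     ∎
    where open ≈-Reasoning

  stirlingSum-suc0 : ∀ n → stirlingSum (suc n) 0 ≈ 0#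
  stirlingSum-suc0 n = trans (+-identityʳ _) (trans (*-congˡ (trans (*-congʳ [0]≈0) (zeroˡ _))) (zeroʳ _))

  -- The q-Newton expansion of powers of [x]

  module _ (x : Carrier) (0≤x : 0# ≤ x) (x≤1 : x ≤ 1#) where

    -- A summand of the theorem's right-hand side once the powers of q and one pair of q-factorials
    -- have cancelled.
    newtonTerm : ℕ → ℕ → Carrier
    newtonTerm n k = qFalling x k / [ k ]! * stirlingSum n k

    newtonTerm-suc : ∀ n k → newtonTerm (suc n) (suc k)
      ≈ [ fromℕ (suc k) ] * newtonTerm n (suc k) + q ^ k * [ x - fromℕ k ] * newtonTerm n k
    newtonTerm-suc n k = begin
      F * X / [ suc k ]! * stirlingSum (suc n) (suc k)
        ≈⟨ *-congˡ (stirlingSum-suc n k) ⟩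
      F * X / [ suc k ]! * (K * (S₁ + q ^ k * S₀))
        ≈⟨ solve 7 (λ F X i K S₁ p S₀ → F :* X :* i :* (K :* (S₁ :+ p :* S₀)) := K :* (F :* X :* i :* S₁) :+ p :* X :* (F :* (K :* i) :* S₀))
             refl F X ([ suc k ]! ⁻¹) K S₁ (q ^ k) S₀ ⟩
      K * (F * X / [ suc k ]! * S₁) + q ^ k * X * (F * (K * [ suc k ]! ⁻¹) * S₀)
        ≈⟨ +-congˡ (*-congˡ (*-congʳ (*-congˡ (y⁻¹≈x[xy]⁻¹ ([1+n]≉0 k) ([n]!≉0 k))))) ⟨
      K * newtonTerm n (suc k) + q ^ k * X * newtonTerm n k ∎
      where
      open ≈-Reasoning
      F = qFalling x k
      X = [ x - fromℕ k ]
      K = [ fromℕ (suc k) ]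
      S₁ = stirlingSum n (suc k)
      S₀ = stirlingSum n k

    newtonTerm-vanish : ∀ n → newtonTerm n (suc n) ≈ 0#
    newtonTerm-vanish n = trans (*-congˡ (stirlingSum-vanish (ℕ.n<1+n n))) (zeroʳ _)

    -- Split [x] = [k] + q^k [x-k] in term k of row n: the first part goes to term k of row n + 1,
    -- the second to term k + 1. Cutting at m leaves over the second part of term m, which is the
    -- extra summand on the left.
    newtonTerm-partialSum : ∀ n m →
      ∑[ 0 ⋯ m ] (newtonTerm (suc n)) + q ^ m * [ x - fromℕ m ] * newtonTerm n m ≈ [ x ] * ∑[ 0 ⋯ m ] (newtonTerm n)
    newtonTerm-partialSum n zero = begin
      newtonTerm (suc n) 0 + 0# + Y * newtonTerm n 0
        ≈⟨ +-cong (+-identityʳ _) refl ⟩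
      newtonTerm (suc n) 0 + Y * newtonTerm n 0
        ≈⟨ +-congʳ (trans (*-congˡ (stirlingSum-suc0 n)) (zeroʳ _)) ⟩
      0# + Y * newtonTerm n 0
        ≈⟨ +-identityˡ _ ⟩
      Y * newtonTerm n 0
        ≈⟨ *-cong (trans ([x]-split 0≤x x≤1 0) (trans (+-congʳ [0]≈0) (+-identityˡ _))) (+-identityʳ (newtonTerm n 0)) ⟨
      [ x ] * (newtonTerm n 0 + 0#) ∎
      where
      open ≈-Reasoning
      Y = q ^ 0 * [ x - fromℕ 0 ]
    newtonTerm-partialSum n (suc m) = begin
      ∑[ 0 ⋯ suc m ] (newtonTerm (suc n)) + Y′ * U
        ≈⟨ +-congʳ (∑-last m (newtonTerm (suc n))) ⟩
      ∑[ 0 ⋯ m ] (newtonTerm (suc n)) + newtonTerm (suc n) (suc m) + Y′ * U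
        ≈⟨ +-congʳ (+-congˡ (newtonTerm-suc n m)) ⟩
      ∑[ 0 ⋯ m ] (newtonTerm (suc n)) + (K * U + Y * newtonTerm n m) + Y′ * U
        ≈⟨ solve 5 (λ s K U y Y′ → s :+ (K :* U :+ y) :+ Y′ :* U := s :+ y :+ (K :+ Y′) :* U)
             refl (∑[ 0 ⋯ m ] (newtonTerm (suc n))) K U (Y * newtonTerm n m) Y′ ⟩
      ∑[ 0 ⋯ m ] (newtonTerm (suc n)) + Y * newtonTerm n m + (K + Y′) * U
        ≈⟨ +-cong (newtonTerm-partialSum n m) (*-congʳ (sym ([x]-split 0≤x x≤1 (suc m)))) ⟩
      [ x ] * ∑[ 0 ⋯ m ] (newtonTerm n) + [ x ] * U
        ≈⟨ distribˡ [ x ] _ _ ⟨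
      [ x ] * (∑[ 0 ⋯ m ] (newtonTerm n) + U)
        ≈⟨ *-congˡ (∑-last m (newtonTerm n)) ⟨
      [ x ] * ∑[ 0 ⋯ suc m ] (newtonTerm n) ∎
      where
      open ≈-Reasoning
      K = [ fromℕ (suc m) ]
      U = newtonTerm n (suc m)
      Y = q ^ m * [ x - fromℕ m ]
      Y′ = q ^ suc m * [ x - fromℕ (suc m) ]

    newtonExpansion : ∀ n → ∑[ 0 ⋯ n ] (newtonTerm n) ≈ [ x ] ^ n
    newtonExpansion zero = begin
      1# / 1# * stirlingSum 0 0 + 0#  ≈⟨ +-identityʳ _ ⟩
      1# / 1# * stirlingSum 0 0       ≈⟨ *-cong (⁻¹-inverseʳ 1≉0) stirlingSum-00 ⟩
      1# * 1#                         ≈⟨ *-identityˡ 1# ⟩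
      1#                              ∎
      where open ≈-Reasoning
    newtonExpansion (suc n) = begin
      ∑[ 0 ⋯ suc n ] (newtonTerm (suc n))
        -- Cutting at n + 1 makes the leftover a multiple of `newtonTerm n (suc n)`, which is zero.
        ≈⟨ +-identityʳ _ ⟨
      ∑[ 0 ⋯ suc n ] (newtonTerm (suc n)) + 0#
        ≈⟨ +-congˡ (trans (*-congˡ (newtonTerm-vanish n)) (zeroʳ _)) ⟨
      ∑[ 0 ⋯ suc n ] (newtonTerm (suc n)) + q ^ suc n * [ x - fromℕ (suc n) ] * newtonTerm n (suc n)
        ≈⟨ newtonTerm-partialSum n (suc n) ⟩
      [ x ] * ∑[ 0 ⋯ suc n ] (newtonTerm n)
        ≈⟨ *-congˡ (∑-last n (newtonTerm n)) ⟩
      [ x ] * (∑[ 0 ⋯ n ] (newtonTerm n) + newtonTerm n (suc n))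
        ≈⟨ *-congˡ (+-cong (newtonExpansion n) (newtonTerm-vanish n)) ⟩
      [ x ] * ([ x ] ^ n + 0#)
        ≈⟨ *-congˡ (+-identityʳ _) ⟩
      [ x ] * [ x ] ^ n ∎
      where open ≈-Reasoning

    stirlingExpansion : ∀ n → ∑[ 0 ⋯ n ] (λ k → q ^ (k C 2) * qBinomial x k * [ k ]! * S n k) ≈ [ x ] ^ n
    stirlingExpansion n = trans (∑-cong n {g = newtonTerm n} λ k _ → begin
      q ^ (k C 2) * (F k / [ k ]!) * [ k ]! * ((q ^ (k C 2)) ⁻¹ / [ k ]! * stirlingSum n k)
        ≈⟨ solve 6 (λ p F i f p′ S → p :* (F :* i) :* f :* (p′ :* i :* S) := p :* p′ :* (F :* i :* f :* i :* S))
             refl (q ^ (k C 2)) (F k) ([ k ]! ⁻¹) [ k ]! ((q ^ (k C 2)) ⁻¹) (stirlingSum n k) ⟩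
      q ^ (k C 2) / q ^ (k C 2) * (F k / [ k ]! * [ k ]! / [ k ]! * stirlingSum n k)
        ≈⟨ *-cong (⁻¹-inverseʳ (^-≉0 (0<x⇒x≉0 0<q) (k C 2))) (*-congʳ (*-congʳ (/-*-cancel ([n]!≉0 k)))) ⟩
      1# * newtonTerm n k
        ≈⟨ *-identityˡ _ ⟩
      newtonTerm n k ∎) (newtonExpansion n)
      where
      open ≈-Reasoning
      F = qFalling x

    [x]+[1-x]≉0 : [ x ] + [ 1# - x ] ≉ 0#
    [x]+[1-x]≉0 [x]+[1-x]≈0 = contradiction-by-half (total (1# - x) x)
      where
      u = 1# - q ^ℝ x
      v = 1# - q ^ℝ (1# - x)
      1-x+x≈1 : 1# - x + x ≈ 1#
      1-x+x≈1 = //-rightDividesˡ x 1#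
      0≤1-x : 0# ≤ 1# - x
      0≤1-x = x≤y⇒0≤y-x x≤1
      1-x≤1 : 1# - x ≤ 1#
      1-x≤1 = begin
        1# - x       ≈⟨ +-identityʳ _ ⟨
        1# - x + 0#  ≤⟨ +-monoʳ-≤ (1# - x) 0≤x ⟩
        1# - x + x   ≈⟨ 1-x+x≈1 ⟩
        1#           ∎
        where open ≤-Reasoning
      0≤u : 0# ≤ u
      0≤u = x≤y⇒0≤y-x (^ℝ-≤1 q 0<q q<1 0≤x x≤1)
      0≤v : 0# ≤ v
      0≤v = x≤y⇒0≤y-x (^ℝ-≤1 q 0<q q<1 0≤1-x 1-x≤1)
      u+v≈0 : u + v ≈ 0#
      u+v≈0 = begin
        u + v                                  ≈⟨ /-*-cancel 1-q≉0 ⟨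
        (u + v) / (1# - q) * (1# - q)          ≈⟨ *-congʳ (distribʳ _ u v) ⟩
        ([ x ] + [ 1# - x ]) * (1# - q)        ≈⟨ *-congʳ [x]+[1-x]≈0 ⟩
        0# * (1# - q)                          ≈⟨ zeroˡ _ ⟩
        0#                                     ∎
        where open ≈-Reasoning
      -- The larger of x and 1 - x is at least 1/2, since they add up to 1; its power of q would be
      -- 1, as `u` and `v` are nonnegative with sum 0.
      contradiction-by-half : (1# - x ≤ x) ⊎ (x ≤ 1# - x) → ⊥
      contradiction-by-half (inj₁ 1-x≤x) = ^ℝ-half-≉1 q 0<q q<1 0≤x x≤1
        (≤-trans (≤-reflexive (sym 1-x+x≈1)) (+-monoˡ-≤ x 1-x≤x))
        (sym (x-y≈0⇒x≈y 1# _ (x+y≈0⇒x≈0 0≤u 0≤v u+v≈0)))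
      contradiction-by-half (inj₂ x≤1-x) = ^ℝ-half-≉1 q 0<q q<1 0≤1-x 1-x≤1
        (≤-trans (≤-reflexive (sym 1-x+x≈1)) (+-monoʳ-≤ (1# - x) x≤1-x))
        (sym (x-y≈0⇒x≈y 1# _ (x+y≈0⇒x≈0 0≤v 0≤u (trans (+-comm v u) u+v≈0))))

theorem8 : (R : CompleteOrderedField) →
    let open CompleteOrderedField R in
    (q : Carrier) → 0# < q → q < 1# →
    let open QBernstein R q in
    (B : ℕ → ℕ → Carrier → Carrier) → IsModifiedBernstein B →
    (n i : ℕ) → 1 ℕ.≤ i → i ℕ.≤ n →
    (x : Carrier) → 0# ≤ x → x ≤ 1# →
    (1# / ([ 1# - x ] + [ x ]) ^ (n ∸ i)) *
    ∑[ i ∸ 1 ⋯ n ] (λ k → (fromℕ (k C i) / fromℕ (n C i)) * B k n x)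
    ≈ ∑[ 0 ⋯ i ] (λ k → q ^ (k C 2) * qBinomial x k * [ k ]! * S i k)
theorem8 R q 0<q q<1 B isB n (suc i) _ i≤n x 0≤x x≤1 with ℕ.m≤n⇒∃[o]m+o≡n i≤n
-- Writing n as `suc i + m` removes the truncated subtraction and matches `bernsteinSum`.
... | m , ≡.refl = begin
  (1# / c ^ (suc i ℕ.+ m ∸ suc i)) * ∑[ i ⋯ suc i ℕ.+ m ] f
    ≡⟨ ≡.cong (λ l → (1# / c ^ l) * ∑[ i ⋯ suc i ℕ.+ m ] f) (ℕ.m+n∸m≡n (suc i) m) ⟩
  (1# / c ^ m) * ∑[ i ⋯ suc i ℕ.+ m ] f
    ≈⟨ *-congˡ (bernsteinSum B isB x 0≤x x≤1 i m) ⟩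
  (1# / c ^ m) * (a ^ suc i * (a + b) ^ m)
    ≈⟨ *-cong (*-identityˡ _) (*-congˡ (^-congˡ m (+-comm a b))) ⟩
  (c ^ m) ⁻¹ * (a ^ suc i * c ^ m)
    ≈⟨ *-comm _ _ ⟩
  a ^ suc i * c ^ m / c ^ m
    ≈⟨ *-/-cancel (^-≉0 (λ c≈0 → [x]+[1-x]≉0 x 0≤x x≤1 (trans (+-comm a b) c≈0)) m) ⟩
  a ^ suc i
    ≈⟨ stirlingExpansion x 0≤x x≤1 (suc i) ⟨
  ∑[ 0 ⋯ suc i ] (λ k → q ^ (k C 2) * qBinomial x k * [ k ]! * S (suc i) k) ∎
  where
  open CompleteOrderedField R
  open QBernstein R q
  open FieldProperties R
  open Bernstein R q
  open QStirling R q 0<q q<1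
  open ≈-Reasoning
  a = [ x ]
  b = [ 1# - x ]
  c = b + a
  f : ℕ → Carrier
  f k = (fromℕ (k C suc i) / fromℕ ((suc i ℕ.+ m) C suc i)) * B k (suc i ℕ.+ m) x
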